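{- For every $k\in\mathbb{N}$ and every integer $s\le k-2$, the sandwich $\Xi^k_s$ is a $(k+1)$-centerpole set in the discrete group $\mathbb{Z}\times\mathbb{Z}^k$: for every map $\chi:\mathbb{Z}\times\mathbb{Z}^k\to\{0,\dots,k\}$ there exist $c\in\Xi^k_s$ and an infinite set $S\subset\mathbb{Z}\times\mathbb{Z}^k$ on which $\chi$ is constant and with $S=2c-S$.
   Context: $\mathbf 2=\{0,1\}$. For a real $s$, $\mathbf 2^k_{<s}=\{(x_i)\in\mathbf 2^k:\sum_{i=1}^kx_i<s\}$ and $\mathbf 2^k_{>s}=\{(x_i)\in\mathbf 2^k:\sum_{i=1}^kx_i>s\}$. The $\binom{k}{s}$-sandwich is the subset $\Xi^k_s=(\{ -1\}\times\mathbf 2^k_{<s})\cup(\{0\}\times\mathbf 2^k_{<k})\cup(\{1\}\times\mathbf 2^k_{>s})$ of $\mathbb{Z}\times\mathbb{Z}^k$. (In a discrete group, unbounded subsets are exactly the infinite ones.) -}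

module Defs where

open import Data.Nat using (ℕ; suc)
open import Data.Integer using (ℤ; +_; -_; _+_; _-_; _*_; _<_; -1ℤ; 0ℤ; 1ℤ)
open import Data.Fin using (Fin)
open import Data.Vec using (Vec; map; zipWith; foldr)
open import Data.Vec.Relation.Unary.All using (All)
open import Data.List using (List)
open import Data.List.Membership.Propositional using (_∈_)
open import Data.Product using (Σ; _×_; _,_)
open import Data.Sum using (_⊎_)
open import Relation.Binary.PropositionalEquality using (_≡_)
open import Relation.Nullary using (¬_)

G : ℕ → Set
G k = ℤ × Vec ℤ k

vsum : ∀ {k} → Vec ℤ k → ℤ
vsum = foldr _ _+_ 0ℤ

Binary : ∀ {k} → Vec ℤ k → Set
Binary = All (λ x → x ≡ 0ℤ ⊎ x ≡ 1ℤ)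

InSandwich : (k : ℕ) → ℤ → G k → Set
InSandwich k s (t , v) =
  Binary v ×
  ((t ≡ -1ℤ × vsum v < s) ⊎ (t ≡ 0ℤ × vsum v < + k) ⊎ (t ≡ 1ℤ × s < vsum v))

reflect : ∀ {k} → G k → G k → G k
reflect (t , v) (t' , v') = ((+ 2) * t - t') , zipWith (λ a b → (+ 2) * a - b) v v'

Finite : ∀ {k} → (G k → Set) → Set
Finite {k} S = Σ (List (G k)) (λ xs → ∀ x → S x → x ∈ xs)

Infinite : ∀ {k} → (G k → Set) → Set
Infinite S = ¬ Finite S

ConstantOn : ∀ {k} → (G k → Fin (suc k)) → (G k → Set) → Set
ConstantOn {k} χ S = Σ (Fin (suc k)) (λ i → ∀ x → S x → χ x ≡ i)

SymmetricAbout : ∀ {k} → G k → (G k → Set) → Set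
SymmetricAbout c S = ∀ x → (S x → S (reflect c x)) × (S (reflect c x) → S x)

{-# OPTIONS --safe #-}
module Submission where

open import Defs
open import Data.Bool using (Bool; true; false; not; _∧_; _xor_)
open import Data.Bool.Properties using (xor-same; xor-comm; xor-assoc; xor-identityʳ)
open import Data.Bool.Solver using (module xor-∧-Solver)
open import Data.Empty using (⊥; ⊥-elim)
open import Data.Fin as Fin using (Fin; zero; suc)
import Data.Fin.Properties as Finₚ
open import Data.Integer as ℤ using (ℤ; +_; _-_; _≤_; 0ℤ; 1ℤ; -1ℤ)
import Data.Integer.Properties as ℤₚ
open import Data.Integer.Tactic.RingSolver using (solve-∀)
open import Data.List using (List; []; _∷_; _++_; _∷ʳ_; allFin; cartesianProduct; concatMap; foldr; length; map; reverse)
open import Data.List.Membership.Propositional using (_∈_)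
import Data.List.Membership.Propositional.Properties as ∈ₚ
import Data.List.Properties as Listₚ
open import Data.List.Relation.Binary.Equality.Propositional using (≋⇒≡)
open import Data.List.Relation.Binary.Permutation.Propositional
  using (_↭_; ↭-refl; ↭-sym; ↭-trans; ↭⇒↭ₛ; prep; swap; trans; refl)
import Data.List.Relation.Binary.Permutation.Propositional.Properties as ↭ₚ
open import Data.List.Relation.Unary.All as All using (All; []; _∷_)
import Data.List.Relation.Unary.All.Properties as Allₚ
open import Data.List.Relation.Unary.AllPairs as AllPairs using (AllPairs; []; _∷_)
import Data.List.Relation.Unary.AllPairs.Properties as AllPairsₚ
open import Data.List.Relation.Unary.Any as Any using (Any; here; there)
open import Data.List.Relation.Unary.Linked using (Linked; []; [-]; _∷_)
import Data.List.Relation.Unary.Linked.Properties as Linkedₚ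
open import Data.List.Relation.Unary.Sorted.TotalOrder.Properties using (↗↭↗⇒≋)
open import Data.Nat as ℕ using (ℕ; zero; suc; ⌊_/2⌋; z≤n; s≤s)
import Data.Nat.Properties as ℕₚ
open import Data.List.Sort ℕₚ.≤-decTotalOrder using (sort; sort-↭; sort-↗)
open import Data.Product using (Σ; _×_; _,_; proj₁; proj₂)
open import Data.Sum using (_⊎_; inj₁; inj₂)
open import Data.Unit using (⊤; tt)
open import Data.Vec as Vec using (Vec; []; _∷_; lookup; replicate; updateAt; zipWith)
import Data.Vec.Properties as Vecₚ
import Data.Vec.Relation.Unary.All as VAll
open import Data.Vec.Relation.Binary.Pointwise.Inductive as PW using (Pointwise; []; _∷_)
open import Function using (_∘_)
open import Relation.Binary.Definitions using (tri<; tri≈; tri>)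
open import Relation.Binary.PropositionalEquality as ≡
  using (_≡_; _≢_; refl; sym; cong; cong₂; subst; setoid; module ≡-Reasoning)
open import Data.List.Relation.Binary.Permutation.Setoid.Properties (setoid ℕ) using (Unique-resp-↭)
open import Relation.Nullary using (¬_; Dec; yes; no)
open import Relation.Nullary.Decidable using (_×-dec_; _⊎-dec_)

-- Suppose no sandwich point works, and put f x = χ (2x). Then f x ≠ f (- y) whenever
-- x - y ∈ Ξ and x is far from the origin. Give a point x the label + f x, and the label
-- - f (- y) to the antipodal copy of y. As in Fan's proof of Tucker's lemma, count mod 2 the
-- simplices whose labels, ordered by colour, alternate in sign; the coboundary of this
-- cochain in one dimension is the sum of its two versions (starting with + or with -) in
-- the next. By induction over the equators of the boundary of the cube [-M, M]^k, the
-- prisms over that sphere contain an odd number of alternating simplices. On the other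
-- hand the sphere at t = 0 bounds a dome in ℤ × ℤ^k: a wall up to height M, and a lid in
-- which each unit cube v + [0, 1]^k is replaced by the cone over its boundary with summit
-- (M + 1, v + (1, …, 1)). Every simplex of the dome lies in a translate y + Ξ, so the
-- prisms extend over the dome by coning off with the centres y. There the k + 2 labels
-- of a simplex would need more than k + 1 colours to alternate, so the number is even.

-- Reflecting 2x in x - y gives -2y; this is why `f` reads χ at doubled points and why compatibility
-- of a lower y with an upper x means x - y ∈ Ξ. Over the equator a later vertex minus an earlier
-- one always lies in the middle layer, so ordinary prisms suffice. In the dome the first vertex of
-- a simplex need not be compatible with the others, because each outer layer admits only some
-- weights: the centre need not be a vertex, and it changes from face to face. The lower side of the
-- homotopy therefore runs over flags of faces, each face labelled through its own centre. The lid
-- cannot be flat: the middle layer omits exactly (1, ..., 1), the long diagonal of a unit cube. The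
-- bound s ≤ k - 2 enters at two places: a weight s may be raised to s + 1 and stay below k, and a
-- summit seen from the far side of its cube has weight k - 1, still above s. Parity yields a bare
-- contradiction, and finiteness of the exceptional sets is available only under double negation;
-- hence the doubly negated conclusion.

private variable
  A A′ : Set
  d k : ℕ

-- Chains and prisms

Chain : Set → Set
Chain A = List (List A)

-- A list is a formal sum mod 2, known only through its values on cochains.
ev : {X : Set} → (X → Bool) → List X → Bool
ev c = foldr (λ σ b → c σ xor b) false

module _ {X : Set} where

  ev-++ : (c : X → Bool) (z z′ : List X) → ev c (z ++ z′) ≡ ev c z xor ev c z′
  ev-++ c []      z′ = refl
  ev-++ c (σ ∷ z) z′ = ≡.trans (cong (c σ xor_) (ev-++ c z z′)) (sym (xor-assoc (c σ) _ _))

  ev-cong-All : {c c′ : X → Bool} {z : List X} → All (λ σ → c σ ≡ c′ σ) z → ev c z ≡ ev c′ z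
  ev-cong-All []       = refl
  ev-cong-All (e ∷ es) = cong₂ _xor_ e (ev-cong-All es)

  ev-cong : {c c′ : X → Bool} → (∀ σ → c σ ≡ c′ σ) → (z : List X) → ev c z ≡ ev c′ z
  ev-cong e z = ev-cong-All (All.universal e z)

  ev-false : {c : X → Bool} {z : List X} → All (λ σ → c σ ≡ false) z → ev c z ≡ false
  ev-false []       = refl
  ev-false (e ∷ es) = cong₂ _xor_ e (ev-false es)

  interchange : ∀ a b c d → (a xor b) xor (c xor d) ≡ (a xor c) xor (b xor d)
  interchange = solve 4 (λ a b c d → ((a :+ b) :+ (c :+ d)) := ((a :+ c) :+ (b :+ d))) refl
    where open xor-∧-Solver

  ev-xor : (c c′ : X → Bool) (z : List X) → ev (λ σ → c σ xor c′ σ) z ≡ ev c z xor ev c′ z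
  ev-xor c c′ []      = refl
  ev-xor c c′ (σ ∷ z) = ≡.trans (cong ((c σ xor c′ σ) xor_) (ev-xor c c′ z))
                                (interchange (c σ) (c′ σ) _ _)

  ev-map : {Y : Set} (c : X → Bool) (h : Y → X) (z : List Y) → ev c (map h z) ≡ ev (c ∘ h) z
  ev-map c h []      = refl
  ev-map c h (σ ∷ z) = cong (c (h σ) xor_) (ev-map c h z)

  ev-concatMap : {Y : Set} (c : X → Bool) (h : Y → List X) (z : List Y) →
                 ev c (concatMap h z) ≡ ev (λ σ → ev c (h σ)) z
  ev-concatMap c h []      = refl
  ev-concatMap c h (σ ∷ z) = ≡.trans (ev-++ c (h σ) (concatMap h z))
                                     (cong (ev c (h σ) xor_) (ev-concatMap c h z))

-- The empty simplex is a face of every vertex: chains are augmented.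
faces : List A → Chain A
faces []      = []
faces (x ∷ σ) = σ ∷ map (x ∷_) (faces σ)

δ : (List A → Bool) → List A → Bool
δ c σ = ev c (faces σ)

δ-∷ : (c : List A → Bool) (x : A) (σ : List A) → δ c (x ∷ σ) ≡ c σ xor δ (c ∘ (x ∷_)) σ
δ-∷ c x σ = cong (c σ xor_) (ev-map c (x ∷_) (faces σ))

δδ : (c : List A → Bool) (σ : List A) → ev (δ c) (faces σ) ≡ false
δδ c []      = refl
δδ c (x ∷ σ) = begin
  δ c σ xor ev (δ c) (map (x ∷_) (faces σ))
    ≡⟨ cong (δ c σ xor_) (ev-map (δ c) (x ∷_) (faces σ)) ⟩
  δ c σ xor ev (λ ρ → δ c (x ∷ ρ)) (faces σ)
    ≡⟨ cong (δ c σ xor_) (ev-cong (δ-∷ c x) (faces σ)) ⟩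
  δ c σ xor ev (λ ρ → c ρ xor δ (c ∘ (x ∷_)) ρ) (faces σ)
    ≡⟨ cong (δ c σ xor_) (ev-xor c _ (faces σ)) ⟩
  δ c σ xor (δ c σ xor ev (δ (c ∘ (x ∷_))) (faces σ))
    ≡⟨ cong (λ b → δ c σ xor (δ c σ xor b)) (δδ (c ∘ (x ∷_)) σ) ⟩
  δ c σ xor (δ c σ xor false)
    ≡⟨ cong (δ c σ xor_) (xor-identityʳ _) ⟩
  δ c σ xor δ c σ
    ≡⟨ xor-same (δ c σ) ⟩
  false ∎
  where open ≡-Reasoning

faces-map : (h : A → A′) (σ : List A) → faces (map h σ) ≡ map (map h) (faces σ)
faces-map h []      = refl
faces-map h (x ∷ σ) = cong (map h σ ∷_) (begin
  map (h x ∷_) (faces (map h σ))       ≡⟨ cong (map _) (faces-map h σ) ⟩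
  map (h x ∷_) (map (map h) (faces σ)) ≡⟨ Listₚ.map-∘ (faces σ) ⟨
  map (map h ∘ (x ∷_)) (faces σ)       ≡⟨ Listₚ.map-∘ (faces σ) ⟩
  map (map h) (map (x ∷_) (faces σ))   ∎)
  where open ≡-Reasoning

faces-All : {P : A → Set} {σ : List A} → All P σ → All (All P) (faces σ)
faces-All []       = []
faces-All (p ∷ ps) = ps ∷ Allₚ.map⁺ (All.map (p ∷_) (faces-All ps))

faces-AllPairs : {R : A → A → Set} {σ : List A} → AllPairs R σ → All (AllPairs R) (faces σ)
faces-AllPairs []       = []
faces-AllPairs (p ∷ ps) =
  ps ∷ Allₚ.map⁺ (All.zipWith (λ (q , r) → q ∷ r) (faces-All p , faces-AllPairs ps))

faces-length : (x : A) (σ : List A) → All (λ ρ → length ρ ≡ length σ) (faces (x ∷ σ))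
faces-length x []      = refl ∷ []
faces-length x (y ∷ σ) = refl ∷ Allₚ.map⁺ (All.map (cong suc) (faces-length y σ))

prism : (A → A′) → (A → A′) → List A → Chain A′
prism lo hi []      = []
prism lo hi (v ∷ σ) = (lo v ∷ hi v ∷ map hi σ) ∷ map (lo v ∷_) (prism lo hi σ)

ev-prism-∷ : (lo hi : A → A′) (c : List A′ → Bool) (v : A) (σ : List A) →
             ev c (prism lo hi (v ∷ σ)) ≡
             c (lo v ∷ hi v ∷ map hi σ) xor ev (c ∘ (lo v ∷_)) (prism lo hi σ)
ev-prism-∷ lo hi c v σ = cong (c (lo v ∷ hi v ∷ map hi σ) xor_) (ev-map c (lo v ∷_) (prism lo hi σ))

-- The homotopy formula ∂P = P∂ + lo + hi mod 2, tested on a cochain. Since `c` is arbitrary, the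
-- induction can test the tail on `c ∘ (lo v ∷_)`.
δ-prism : (lo hi : A → A′) (c : List A′ → Bool) (σ : List A) →
          ev (δ c) (prism lo hi σ) ≡
          δ (λ ρ → ev c (prism lo hi ρ)) σ xor (c (map lo σ) xor c (map hi σ))
δ-prism lo hi c []      = sym (xor-same (c []))
δ-prism lo hi c (v ∷ σ) = begin
  ev (δ c) (prism lo hi (v ∷ σ))
    ≡⟨ ev-prism-∷ lo hi (δ c) v σ ⟩
  δ c (lo v ∷ hi v ∷ map hi σ) xor ev (δ c ∘ (lo v ∷_)) (prism lo hi σ)
    ≡⟨ cong₂ _xor_ first second ⟩
  (h xor (l xor e)) xor (p xor (q xor (r xor l)))
    ≡⟨ solve 6 (λ h l e p q r → ((h :+ (l :+ e)) :+ (p :+ (q :+ (r :+ l))))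
                             := ((p :+ (e :+ q)) :+ (r :+ (h :+ (l :+ l))))) refl h l e p q r ⟩
  (p xor (e xor q)) xor (r xor (h xor (l xor l)))
    ≡⟨ cong (λ b → (p xor (e xor q)) xor (r xor b))
            (≡.trans (cong (h xor_) (xor-same l)) (xor-identityʳ h)) ⟩
  (p xor (e xor q)) xor (r xor h)
    ≡⟨ cong (λ b → (p xor b) xor (r xor h)) faces-part ⟨
  δ (λ ρ → ev c (prism lo hi ρ)) (v ∷ σ) xor (r xor h) ∎
  where
  open ≡-Reasoning
  open xor-∧-Solver using (solve; _:=_; _:+_)
  c′ = c ∘ (lo v ∷_)
  h = c (hi v ∷ map hi σ)
  l = c (lo v ∷ map hi σ)
  e = ev (λ ρ → c (lo v ∷ hi v ∷ map hi ρ)) (faces σ)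
  p = ev c (prism lo hi σ)
  q = δ (λ ρ → ev c′ (prism lo hi ρ)) σ
  r = c (lo v ∷ map lo σ)
  first : δ c (lo v ∷ hi v ∷ map hi σ) ≡ h xor (l xor e)
  first = cong (h xor_) (≡.trans (ev-map c (lo v ∷_) (faces (hi v ∷ map hi σ)))
    (cong (l xor_) (≡.trans (ev-map c′ (hi v ∷_) (faces (map hi σ)))
      (≡.trans (cong (ev (c′ ∘ (hi v ∷_))) (faces-map hi σ)) (ev-map (λ ρ → c (lo v ∷ hi v ∷ ρ)) (map hi) (faces σ))))))
  second : ev (δ c ∘ (lo v ∷_)) (prism lo hi σ) ≡ p xor (q xor (r xor l))
  second = ≡.trans (ev-cong (δ-∷ c (lo v)) (prism lo hi σ))
    (≡.trans (ev-xor c (δ c′) (prism lo hi σ)) (cong (p xor_) (δ-prism lo hi c′ σ)))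
  faces-part : ev (λ ρ → ev c (prism lo hi ρ)) (map (v ∷_) (faces σ)) ≡ e xor q
  faces-part = ≡.trans (ev-map (λ ρ → ev c (prism lo hi ρ)) (v ∷_) (faces σ))
    (≡.trans (ev-cong (ev-prism-∷ lo hi c v) (faces σ))
             (ev-xor (λ ρ → c (lo v ∷ hi v ∷ map hi ρ)) (λ ρ → ev c′ (prism lo hi ρ)) (faces σ)))

prism-map : {A″ : Set} (lo hi : A′ → A″) (h : A → A′) (σ : List A) →
            prism lo hi (map h σ) ≡ prism (lo ∘ h) (hi ∘ h) σ
prism-map lo hi h []      = refl
prism-map lo hi h (v ∷ σ) =
  cong₂ (λ a b → (lo (h v) ∷ hi (h v) ∷ a) ∷ map (lo (h v) ∷_) b) (sym (Listₚ.map-∘ σ)) (prism-map lo hi h σ)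

map-prism : {A″ : Set} (h : A′ → A″) (lo hi : A → A′) (σ : List A) →
            map (map h) (prism lo hi σ) ≡ prism (h ∘ lo) (h ∘ hi) σ
map-prism h lo hi []      = refl
map-prism h lo hi (v ∷ σ) = cong₂ (λ a b → (h (lo v) ∷ h (hi v) ∷ a) ∷ b) (sym (Listₚ.map-∘ σ)) (begin
  map (map h) (map (lo v ∷_) (prism lo hi σ))      ≡⟨ Listₚ.map-∘ (prism lo hi σ) ⟨
  map (λ w → h (lo v) ∷ map h w) (prism lo hi σ)   ≡⟨ Listₚ.map-∘ (prism lo hi σ) ⟩
  map (h (lo v) ∷_) (map (map h) (prism lo hi σ))  ≡⟨ cong (map _) (map-prism h lo hi σ) ⟩
  map (h (lo v) ∷_) (prism (h ∘ lo) (h ∘ hi) σ)    ∎)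
  where open ≡-Reasoning

prism-cong : {lo lo′ hi hi′ : A → A′} → (∀ v → lo v ≡ lo′ v) → (∀ v → hi v ≡ hi′ v) →
             (σ : List A) → prism lo hi σ ≡ prism lo′ hi′ σ
prism-cong p q []      = refl
prism-cong p q (v ∷ σ) =
  cong₂ _∷_ (cong₂ _∷_ (p v) (cong₂ _∷_ (q v) (Listₚ.map-cong q σ)))
            (cong₂ (λ x → map (x ∷_)) (p v) (prism-cong p q σ))

prism-∷ʳ : (lo hi : A → A′) (c : List A′ → Bool) (σ : List A) (v : A) →
           ev c (prism lo hi (σ ∷ʳ v)) ≡
           c (map lo σ ++ lo v ∷ hi v ∷ []) xor ev (c ∘ (_∷ʳ hi v)) (prism lo hi σ)
prism-∷ʳ lo hi c []      v = refl
prism-∷ʳ lo hi c (u ∷ σ) v = begin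
  ev c (prism lo hi (u ∷ σ ∷ʳ v))
    ≡⟨ ev-prism-∷ lo hi c u (σ ∷ʳ v) ⟩
  c (lo u ∷ hi u ∷ map hi (σ ∷ʳ v)) xor ev (c ∘ (lo u ∷_)) (prism lo hi (σ ∷ʳ v))
    ≡⟨ cong₂ _xor_ (cong (λ x → c (lo u ∷ hi u ∷ x)) (Listₚ.map-++ hi σ (v ∷ [])))
                   (prism-∷ʳ lo hi (c ∘ (lo u ∷_)) σ v) ⟩
  a xor (b xor e)
    ≡⟨ solve 3 (λ a b e → (a :+ (b :+ e)) := (b :+ (a :+ e))) refl a b e ⟩
  b xor (a xor e)
    ≡⟨ cong (b xor_) (ev-prism-∷ lo hi (c ∘ (_∷ʳ hi v)) u σ) ⟨
  b xor ev (c ∘ (_∷ʳ hi v)) (prism lo hi (u ∷ σ)) ∎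
  where
  open ≡-Reasoning
  open xor-∧-Solver using (solve; _:=_; _:+_)
  a = c (lo u ∷ hi u ∷ (map hi σ ∷ʳ hi v))
  b = c (lo u ∷ map lo σ ++ lo v ∷ hi v ∷ [])
  e = ev (λ w → c (lo u ∷ (w ∷ʳ hi v))) (prism lo hi σ)

-- Read backwards, a path that climbs from `lo` to `hi` is one that descends. This is needed because
-- the antipodal map reverses the order of the vertices.
prism-reverse : (lo hi : A → A′) (c : List A′ → Bool) (σ : List A) →
                ev c (prism lo hi (reverse σ)) ≡ ev (c ∘ reverse) (prism hi lo σ)
prism-reverse lo hi c []      = refl
prism-reverse lo hi c (v ∷ σ) = begin
  ev c (prism lo hi (reverse (v ∷ σ)))
    ≡⟨ cong (ev c ∘ prism lo hi) (Listₚ.unfold-reverse v σ) ⟩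
  ev c (prism lo hi (reverse σ ∷ʳ v))
    ≡⟨ prism-∷ʳ lo hi c (reverse σ) v ⟩
  c (map lo (reverse σ) ++ lo v ∷ hi v ∷ []) xor ev (c ∘ (_∷ʳ hi v)) (prism lo hi (reverse σ))
    ≡⟨ cong₂ (λ a b → c a xor b) word (prism-reverse lo hi (c ∘ (_∷ʳ hi v)) σ) ⟩
  c (reverse (hi v ∷ lo v ∷ map lo σ)) xor ev (λ w → c (reverse w ∷ʳ hi v)) (prism hi lo σ)
    ≡⟨ cong (c (reverse (hi v ∷ lo v ∷ map lo σ)) xor_)
            (ev-cong (λ w → cong c (sym (Listₚ.unfold-reverse (hi v) w))) (prism hi lo σ)) ⟩
  c (reverse (hi v ∷ lo v ∷ map lo σ)) xor ev (c ∘ reverse ∘ (hi v ∷_)) (prism hi lo σ)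
    ≡⟨ ev-prism-∷ hi lo (c ∘ reverse) v σ ⟨
  ev (c ∘ reverse) (prism hi lo (v ∷ σ)) ∎
  where
  open ≡-Reasoning
  word : map lo (reverse σ) ++ lo v ∷ hi v ∷ [] ≡ reverse (hi v ∷ lo v ∷ map lo σ)
  word = begin
    map lo (reverse σ) ++ lo v ∷ hi v ∷ []         ≡⟨ cong (_++ _) (Listₚ.reverse-map lo σ) ⟩
    reverse (map lo σ) ++ lo v ∷ hi v ∷ []         ≡⟨ Listₚ.++-assoc (reverse (map lo σ)) (lo v ∷ []) _ ⟨
    (reverse (map lo σ) ∷ʳ lo v) ∷ʳ hi v           ≡⟨ cong (_∷ʳ hi v) (Listₚ.unfold-reverse (lo v) (map lo σ)) ⟨
    reverse (lo v ∷ map lo σ) ∷ʳ hi v              ≡⟨ Listₚ.unfold-reverse (hi v) (lo v ∷ map lo σ) ⟨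
    reverse (hi v ∷ lo v ∷ map lo σ)               ∎

prism-length : (lo hi : A → A′) (σ : List A) → All (λ w → length w ≡ suc (length σ)) (prism lo hi σ)
prism-length lo hi []      = []
prism-length lo hi (v ∷ σ) =
  cong (2 ℕ.+_) (Listₚ.length-map hi σ) ∷ Allₚ.map⁺ (All.map (cong suc) (prism-length lo hi σ))

prism-All : {P : A → Set} {Q : A′ → Set} {lo hi : A → A′} →
            (∀ {v} → P v → Q (lo v)) → (∀ {v} → P v → Q (hi v)) →
            {σ : List A} → All P σ → All (All Q) (prism lo hi σ)
prism-All p q []       = []
prism-All p q (r ∷ rs) = (p r ∷ q r ∷ Allₚ.map⁺ (All.map q rs)) ∷ Allₚ.map⁺ (All.map (p r ∷_) (prism-All p q rs))

-- The alternating cochain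

-- A label 2c is colour c with sign false, and 2c + 1 is colour c with sign true.
sgn : ℕ → Bool
sgn 0             = false
sgn 1             = true
sgn (suc (suc n)) = sgn n

flip : ℕ → ℕ
flip 0             = 1
flip 1             = 0
flip (suc (suc n)) = suc (suc (flip n))

sgn-flip : ∀ n → sgn (flip n) ≡ not (sgn n)
sgn-flip 0             = refl
sgn-flip 1             = refl
sgn-flip (suc (suc n)) = sgn-flip n

flip-involutive : ∀ n → flip (flip n) ≡ n
flip-involutive 0             = refl
flip-involutive 1             = refl
flip-involutive (suc (suc n)) = cong (2 ℕ.+_) (flip-involutive n)

-- `flip` only exchanges 2c with 2c + 1, so it can break an inequality only inside one such pair.
flip-mono : ∀ {m n} → m ℕ.≤ n → n ≢ flip m → flip m ℕ.≤ flip n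
flip-mono {0}           {0}           _ _ = ℕₚ.≤-refl
flip-mono {0}           {1}           _ e = ⊥-elim (e refl)
flip-mono {0}           {suc (suc n)} _ _ = s≤s z≤n
flip-mono {1}           {1}           _ _ = z≤n
flip-mono {1}           {suc (suc n)} _ _ = z≤n
flip-mono {suc (suc m)} {suc (suc n)} (s≤s (s≤s p)) e = s≤s (s≤s (flip-mono p (e ∘ cong (2 ℕ.+_))))

⌊/2⌋-strict : ∀ {m n} → m ℕ.< n → n ≢ flip m → ⌊ m /2⌋ ℕ.< ⌊ n /2⌋
⌊/2⌋-strict {0}           {1}           _ e = ⊥-elim (e refl)
⌊/2⌋-strict {0}           {suc (suc n)} _ _ = s≤s z≤n
⌊/2⌋-strict {1}           {1}           (s≤s ()) _
⌊/2⌋-strict {1}           {suc (suc n)} _ _ = s≤s z≤n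
⌊/2⌋-strict {suc (suc m)} {suc (suc n)} (s≤s (s≤s p)) e = s≤s (⌊/2⌋-strict p (e ∘ cong (2 ℕ.+_)))

eqᵇ : Bool → Bool → Bool
eqᵇ true  b = b
eqᵇ false b = not b

alternates : Bool → List ℕ → Bool
alternates s []      = true
alternates s (x ∷ w) = eqᵇ s (sgn x) ∧ alternates (not s) w

-- Sorting labels sorts them by colour. It also makes the cochain independent of the order of the
-- vertices, so that a reversed simplex counts like the original.
alt : Bool → List ℕ → Bool
alt s w = alternates s (sort w)

sort-cong : ∀ {w w′} → w ↭ w′ → sort w ≡ sort w′
sort-cong {w} {w′} p = ≋⇒≡ (↗↭↗⇒≋ ℕₚ.≤-totalOrder (sort-↗ w) (sort-↗ w′)
  (↭⇒↭ₛ (↭-trans (sort-↭ w) (↭-trans p (↭-sym (sort-↭ w′))))))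

alt-cong : ∀ s {w w′} → w ↭ w′ → alt s w ≡ alt s w′
alt-cong s p = cong (alternates s) (sort-cong p)

δ-cong-↭ : {c : List A → Bool} → (∀ {w w′} → w ↭ w′ → c w ≡ c w′) → ∀ {w w′} → w ↭ w′ → δ c w ≡ δ c w′
δ-cong-↭ i refl = refl
δ-cong-↭ {c = c} i (prep {xs} {ys} x p) = ≡.trans (δ-∷ c x xs)
  (≡.trans (cong₂ _xor_ (i p) (δ-cong-↭ (i ∘ prep x) p)) (sym (δ-∷ c x ys)))
δ-cong-↭ {c = c} i (swap {xs} {ys} x y p) = begin
  δ c (x ∷ y ∷ xs)
    ≡⟨ ≡.trans (δ-∷ c x (y ∷ xs)) (cong (c (y ∷ xs) xor_) (δ-∷ (c ∘ (x ∷_)) y xs)) ⟩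
  c (y ∷ xs) xor (c (x ∷ xs) xor δ (λ w → c (x ∷ y ∷ w)) xs)
    ≡⟨ cong₂ _xor_ (i (prep y p)) (cong₂ _xor_ (i (prep x p))
         (≡.trans (ev-cong (λ w → i (swap x y ↭-refl)) (faces xs))
                  (δ-cong-↭ (i ∘ prep y ∘ prep x) p))) ⟩
  c (y ∷ ys) xor (c (x ∷ ys) xor δ (λ w → c (y ∷ x ∷ w)) ys)
    ≡⟨ solve 3 (λ a b d → (a :+ (b :+ d)) := (b :+ (a :+ d))) refl (c (y ∷ ys)) (c (x ∷ ys)) _ ⟩
  c (x ∷ ys) xor (c (y ∷ ys) xor δ (λ w → c (y ∷ x ∷ w)) ys)
    ≡⟨ ≡.trans (δ-∷ c y (x ∷ ys)) (cong (c (x ∷ ys) xor_) (δ-∷ (c ∘ (y ∷_)) x ys)) ⟨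
  δ c (y ∷ x ∷ ys) ∎
  where
  open ≡-Reasoning
  open xor-∧-Solver using (solve; _:=_; _:+_)
δ-cong-↭ i (trans p q) = ≡.trans (δ-cong-↭ i p) (δ-cong-↭ i q)

ev-∧ : {X : Set} (b : Bool) (c : X → Bool) (z : List X) → ev (λ σ → b ∧ c σ) z ≡ b ∧ ev c z
ev-∧ true  c z = refl
ev-∧ false c z = ev-false (All.universal (λ _ → refl) z)

-- Deleting a letter from a word gives an alternating word in an odd number of
-- ways exactly when the word alternates: inside a repeated pair two deletions cancel.
δ-alternates : ∀ s w → δ (alternates s) w ≡ alternates s w xor alternates (not s) w
δ-alternates s []      = refl
δ-alternates s (x ∷ w) = begin
  δ (alternates s) (x ∷ w)
    ≡⟨ δ-∷ (alternates s) x w ⟩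
  alternates s w xor ev (λ ρ → eqᵇ s (sgn x) ∧ alternates (not s) ρ) (faces w)
    ≡⟨ cong (alternates s w xor_) (ev-∧ (eqᵇ s (sgn x)) (alternates (not s)) (faces w)) ⟩
  alternates s w xor (eqᵇ s (sgn x) ∧ δ (alternates (not s)) w)
    ≡⟨ cong (λ b → alternates s w xor (eqᵇ s (sgn x) ∧ b)) (δ-alternates (not s) w) ⟩
  alternates s w xor (eqᵇ s (sgn x) ∧ (alternates (not s) w xor alternates (not (not s)) w))
    ≡⟨ cases s (sgn x) ⟩
  alternates s (x ∷ w) xor alternates (not s) (x ∷ w) ∎
  where
  open ≡-Reasoning
  rearrange : ∀ a b → a xor (b xor a) ≡ b xor false
  rearrange false false = refl
  rearrange false true  = refl
  rearrange true  false = refl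
  rearrange true  true  = refl
  cases : ∀ s t → alternates s w xor (eqᵇ s t ∧ (alternates (not s) w xor alternates (not (not s)) w)) ≡
          (eqᵇ s t ∧ alternates (not s) w) xor (eqᵇ (not s) t ∧ alternates (not (not s)) w)
  cases true  true  = rearrange (alternates true w) (alternates false w)
  cases true  false = xor-identityʳ _
  cases false true  = xor-identityʳ _
  cases false false = rearrange (alternates false w) (alternates true w)

-- The coboundary of a permutation-invariant cochain is permutation-invariant, so `w` may be taken
-- sorted; its faces are then sorted too, and the claim is the one about `alternates`.
δ-alt : ∀ s w → δ (alt s) w ≡ alt s w xor alt (not s) w
δ-alt s w = begin
  δ (alt s) w
    ≡⟨ δ-cong-↭ (alt-cong s) (↭-sym (sort-↭ w)) ⟩
  δ (alt s) (sort w)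
    ≡⟨ ev-cong-All (sorted-faces (sort-↗ w)) ⟩
  δ (alternates s) (sort w)
    ≡⟨ δ-alternates s (sort w) ⟩
  alt s w xor alt (not s) w ∎
  where
  open ≡-Reasoning
  sort-sorted : ∀ {l} → Linked ℕ._≤_ l → sort l ≡ l
  sort-sorted {l} p = ≋⇒≡ (↗↭↗⇒≋ ℕₚ.≤-totalOrder (sort-↗ l) p (↭⇒↭ₛ (sort-↭ l)))
  sorted-faces : ∀ {l} → Linked ℕ._≤_ l → All (λ ρ → alt s ρ ≡ alternates s ρ) (faces l)
  sorted-faces p = All.map (λ q → cong (alternates s) (sort-sorted (Linkedₚ.AllPairs⇒Linked q)))
                           (faces-AllPairs (Linkedₚ.Linked⇒AllPairs ℕₚ.≤-trans p))

-- Tucker's condition that no edge is complementary, for the labels of one simplex: no colour occurs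
-- with both signs.
Proper : List ℕ → Set
Proper w = ∀ {x} → x ∈ w → flip x ∈ w → ⊥

-- In a proper word `flip` keeps the sorted order and negates every sign, so sorting commutes with
-- it.
alt-flip : ∀ s w → Proper w → alt s (map flip w) ≡ alt (not s) w
alt-flip s w pr = ≡.trans (cong (alternates s) sort-flip) (alternates-flip s (sort w))
  where
  alternates-flip : ∀ s l → alternates s (map flip l) ≡ alternates (not s) l
  alternates-flip s []      = refl
  alternates-flip s (x ∷ l) = cong₂ _∧_ (≡.trans (cong (eqᵇ s) (sgn-flip x)) (eqᵇ-not s (sgn x)))
                                        (alternates-flip (not s) l)
    where
    eqᵇ-not : ∀ s t → eqᵇ s (not t) ≡ eqᵇ (not s) t
    eqᵇ-not true  t     = refl
    eqᵇ-not false true  = refl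
    eqᵇ-not false false = refl
  flip-sorted : ∀ {l} → Proper l → Linked ℕ._≤_ l → Linked ℕ._≤_ (map flip l)
  flip-sorted pr []       = []
  flip-sorted pr [-]      = [-]
  flip-sorted pr (p ∷ ps) =
    flip-mono p (λ { refl → pr (here refl) (there (here refl)) }) ∷ flip-sorted (λ i j → pr (there i) (there j)) ps
  sort-flip : sort (map flip w) ≡ map flip (sort w)
  sort-flip = ≋⇒≡ (↗↭↗⇒≋ ℕₚ.≤-totalOrder (sort-↗ (map flip w))
    (flip-sorted (λ i j → pr (↭ₚ.∈-resp-↭ (sort-↭ w) i) (↭ₚ.∈-resp-↭ (sort-↭ w) j)) (sort-↗ w))
    (↭⇒↭ₛ (↭-trans (sort-↭ (map flip w)) (↭ₚ.map⁺ flip (↭-sym (sort-↭ w))))))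

alternates-strict : ∀ s {l} → alternates s l ≡ true → Linked ℕ._≤_ l → Linked ℕ._<_ l
alternates-strict s                 e []       = []
alternates-strict s                 e [-]      = [-]
alternates-strict s {x ∷ y ∷ l} e (p ∷ ps) =
  ℕₚ.≤∧≢⇒< p (λ { refl → clash s (sgn x) e }) ∷ alternates-strict (not s) (tail (eqᵇ s (sgn x)) e) ps
  where
  tail : ∀ a {b} → a ∧ b ≡ true → b ≡ true
  tail true e = e
  clash : ∀ s t {b} → eqᵇ s t ∧ (eqᵇ (not s) t ∧ b) ≡ true → ⊥
  clash true  true  ()
  clash true  false ()
  clash false true  ()
  clash false false ()

alt-true : ∀ s w → alt s w ≡ true → Linked ℕ._<_ (sort w)
alt-true s w e = alternates-strict s e (sort-↗ w)

¬true⇒false : ∀ {b} → (b ≡ true → ⊥) → b ≡ false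
¬true⇒false {true}  f = ⊥-elim (f refl)
¬true⇒false {false} f = refl

-- An alternating word has no repeated letter, and a proper one has no two letters of one colour
-- with opposite signs. Its sorted colours thus increase strictly, and only `m` of them are
-- available.
alt-long : ∀ s m {w} → Proper w → All (λ x → ⌊ x /2⌋ ℕ.< m) w → m ℕ.< length w → alt s w ≡ false
alt-long s m {w} pr bd lt = ¬true⇒false λ e → ℕₚ.<⇒≱ lt (subst (ℕ._≤ m) (↭ₚ.↭-length (sort-↭ w))
  (bounded (λ i j → pr (↭ₚ.∈-resp-↭ (sort-↭ w) i) (↭ₚ.∈-resp-↭ (sort-↭ w) j))
           (alt-true s w e) (↭ₚ.All-resp-↭ (↭-sym (sort-↭ w)) bd)))
  where
  -- The colour of the first letter is part of the bound, since it uses up the colours below it.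
  bounded′ : ∀ {x l} → Proper (x ∷ l) → Linked ℕ._<_ (x ∷ l) → All (λ x → ⌊ x /2⌋ ℕ.< m) (x ∷ l) →
             length (x ∷ l) ℕ.+ ⌊ x /2⌋ ℕ.≤ m
  bounded′ pr [-]      (b ∷ [])     = b
  bounded′ {x} {y ∷ l} pr (p ∷ ps) (_ ∷ bs) = ℕₚ.≤-trans
    (subst (ℕ._≤ length (y ∷ l) ℕ.+ ⌊ y /2⌋) (ℕₚ.+-suc (length (y ∷ l)) ⌊ x /2⌋)
      (ℕₚ.+-monoʳ-≤ (length (y ∷ l)) (⌊/2⌋-strict p (λ { refl → pr (here refl) (there (here refl)) }))))
    (bounded′ (λ i j → pr (there i) (there j)) ps bs)
  bounded : ∀ {l} → Proper l → Linked ℕ._<_ l → All (λ x → ⌊ x /2⌋ ℕ.< m) l → length l ℕ.≤ m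
  bounded {[]}    pr ps bs = z≤n
  bounded {x ∷ l} pr ps bs = ℕₚ.≤-trans (ℕₚ.m≤m+n _ _) (bounded′ pr ps bs)

-- Degenerate words do not count; this is what reduces cones to prisms over the equator.
alt-repeat : ∀ s π x w → alt s (π ++ x ∷ x ∷ w) ≡ false
alt-repeat s π x w = ¬true⇒false λ e → repeated
  (AllPairs-resp (alt-true s (π ++ x ∷ x ∷ w) e) (↭-trans (sort-↭ _) (↭ₚ.shifts π (x ∷ x ∷ []))))
  where
  AllPairs-resp : ∀ {l l′} → Linked ℕ._<_ l → l ↭ l′ → AllPairs _≢_ l′
  AllPairs-resp p q = Unique-resp-↭ (↭⇒↭ₛ q) (AllPairs.map ℕₚ.<⇒≢ (Linkedₚ.Linked⇒AllPairs ℕₚ.<-trans p))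
  repeated : ∀ {l} → AllPairs _≢_ (x ∷ x ∷ l) → ⊥
  repeated ((p ∷ _) ∷ _) = p refl

alt-constant : ∀ b {w} → All (λ x → sgn x ≡ b) w → 2 ℕ.≤ length w → ∀ s → alt s w ≡ false
alt-constant b {w} p q s = constant (sort w) (↭ₚ.All-resp-↭ (↭-sym (sort-↭ w)) p)
  (subst (2 ℕ.≤_) (sym (↭ₚ.↭-length (sort-↭ w))) q) s
  where
  constant : ∀ l → All (λ x → sgn x ≡ b) l → 2 ℕ.≤ length l → ∀ s → alternates s l ≡ false
  constant (x ∷ [])     _               (s≤s ()) s
  constant (x ∷ y ∷ l) (refl ∷ e ∷ _) _ s = subst (λ t → eqᵇ s (sgn x) ∧ (eqᵇ (not s) t ∧ _) ≡ false) (sym e) (case s (sgn x))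
    where
    case : ∀ s t {b} → eqᵇ s t ∧ (eqᵇ (not s) t ∧ b) ≡ false
    case true  true  = refl
    case true  false = refl
    case false true  = refl
    case false false = refl

alt-negative : ∀ {w} → All (λ x → sgn x ≡ false) w → 1 ℕ.≤ length w → alt true w ≡ false
alt-negative {w} p q = negative (sort w) (↭ₚ.All-resp-↭ (↭-sym (sort-↭ w)) p)
  (subst (1 ℕ.≤_) (sym (↭ₚ.↭-length (sort-↭ w))) q)
  where
  negative : ∀ l → All (λ x → sgn x ≡ false) l → 1 ℕ.≤ length l → alternates true l ≡ false
  negative (x ∷ l) (e ∷ _) _ rewrite e = refl

double : ℕ → ℕ
double zero    = zero
double (suc n) = suc (suc (double n))

minus plus : ℕ → ℕ
minus c = double c
plus c  = suc (double c)

sgn-minus : ∀ c → sgn (minus c) ≡ false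
sgn-minus zero    = refl
sgn-minus (suc c) = sgn-minus c

sgn-plus : ∀ c → sgn (plus c) ≡ true
sgn-plus zero    = refl
sgn-plus (suc c) = sgn-plus c

flip-minus : ∀ c → flip (minus c) ≡ plus c
flip-minus zero    = refl
flip-minus (suc c) = cong (2 ℕ.+_) (flip-minus c)

flip-plus : ∀ c → flip (plus c) ≡ minus c
flip-plus zero    = refl
flip-plus (suc c) = cong (2 ℕ.+_) (flip-plus c)

colour-minus : ∀ c → ⌊ minus c /2⌋ ≡ c
colour-minus zero    = refl
colour-minus (suc c) = cong suc (colour-minus c)

colour-plus : ∀ c → ⌊ plus c /2⌋ ≡ c
colour-plus zero    = refl
colour-plus (suc c) = cong suc (colour-plus c)

prism-AllPairs : {R : A → A → Set} {R′ : A′ → A′ → Set} {lo hi : A → A′} →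
                 (∀ {v u} → R v u → R′ (lo v) (lo u)) →
                 (∀ {v u} → R v u → R′ (lo v) (hi u)) → (∀ {v u} → R v u → R′ (hi v) (hi u)) →
                 {σ : List A} → All (λ v → R′ (lo v) (hi v)) σ → AllPairs R σ →
                 All (AllPairs R′) (prism lo hi σ)
prism-AllPairs q r s []       []       = []
prism-AllPairs q r s (p ∷ ps) (a ∷ as) =
  ((p ∷ Allₚ.map⁺ (All.map r a)) ∷ Allₚ.map⁺ (All.map s a) ∷ AllPairsₚ.map⁺ (AllPairs.map s as)) ∷
  Allₚ.map⁺ (All.zipWith (λ (x , y) → x ∷ y) (prism-All q r a , prism-AllPairs q r s ps as))

δ-map : (h : A → A′) (c : List A′ → Bool) (σ : List A) → δ c (map h σ) ≡ δ (c ∘ map h) σ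
δ-map h c σ = ≡.trans (cong (ev c) (faces-map h σ)) (ev-map c (map h) (faces σ))

-- Boxes and spheres

Point : ℕ → Set
Point = Vec ℤ

at : ℤ → Chain (Point d) → Chain (Point (suc d))
at a = map (map (a ∷_))

column : ℤ → ℕ → List (Point d) → Chain (Point (suc d))
column a zero    σ = []
column a (suc n) σ = prism (a ∷_) (1ℤ ℤ.+ a ∷_) σ ++ column (1ℤ ℤ.+ a) n σ

tower : ℤ → ℕ → Chain (Point d) → Chain (Point (suc d))
tower a n = concatMap (column a n)

-- The Freudenthal triangulation of a cube of side `n`, obtained by iterated prisms: along a simplex
-- every coordinate rises by at most one in total.
box : Point d → ℕ → Chain (Point d)
box []       n = ([] ∷ []) ∷ []
box (a ∷ as) n = tower a n (box as n)

-- In dimension zero the augmented boundary of the point is the empty simplex. No prism stands over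
-- the empty simplex, so in dimension one just the two end points remain.
shell : Point d → ℕ → Chain (Point d)
shell []       n = [] ∷ []
shell (a ∷ as) n = at a (box as n) ++ at (a ℤ.+ + n) (box as n) ++ tower a n (shell as n)

module _ (c : List (Point (suc d)) → Bool) where

  ev-at : ∀ a z → ev c (at a z) ≡ ev (c ∘ map (a ∷_)) z
  ev-at a z = ev-map c (map (a ∷_)) z

  ev-tower : ∀ a n z → ev c (tower a n z) ≡ ev (λ σ → ev c (column a n σ)) z
  ev-tower a n z = ev-concatMap c (column a n) z

  δ-column : ∀ a n σ → ev (δ c) (column a n σ) ≡
             δ (λ ρ → ev c (column a n ρ)) σ xor (c (map (a ∷_) σ) xor c (map (a ℤ.+ + n ∷_) σ))
  δ-column a zero σ = sym (begin
    δ (λ ρ → false) σ xor (c (map (a ∷_) σ) xor c (map (a ℤ.+ 0ℤ ∷_) σ))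
      ≡⟨ cong₂ _xor_ (ev-false {z = faces σ} (All.universal (λ _ → refl) _))
                     (cong (λ b → c (map (a ∷_) σ) xor c (map (b ∷_) σ)) (ℤₚ.+-identityʳ a)) ⟩
    c (map (a ∷_) σ) xor c (map (a ∷_) σ)
      ≡⟨ xor-same (c (map (a ∷_) σ)) ⟩
    false ∎)
    where open ≡-Reasoning
  δ-column a (suc n) σ = begin
    ev (δ c) (prism (a ∷_) (b ∷_) σ ++ column b n σ)
      ≡⟨ ev-++ (δ c) (prism (a ∷_) (b ∷_) σ) (column b n σ) ⟩
    ev (δ c) (prism (a ∷_) (b ∷_) σ) xor ev (δ c) (column b n σ)
      ≡⟨ cong₂ _xor_ (δ-prism (a ∷_) (b ∷_) c σ) (δ-column b n σ) ⟩
    (p xor (x xor y)) xor (q xor (y xor c (map (b ℤ.+ + n ∷_) σ)))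
      ≡⟨ cong (λ e → (p xor (x xor y)) xor (q xor (y xor c (map (e ∷_) σ)))) (shift a (+ n)) ⟩
    (p xor (x xor y)) xor (q xor (y xor z))
      ≡⟨ solve 5 (λ p q x y z → ((p :+ (x :+ y)) :+ (q :+ (y :+ z))) :=
                                ((p :+ q) :+ (x :+ ((y :+ y) :+ z)))) refl p q x y z ⟩
    (p xor q) xor (x xor ((y xor y) xor z))
      ≡⟨ cong (λ e → (p xor q) xor (x xor (e xor z))) (xor-same y) ⟩
    (p xor q) xor (x xor z)
      ≡⟨ cong (_xor (x xor z)) (≡.trans (ev-cong (λ ρ → ev-++ c (prism (a ∷_) (b ∷_) ρ) (column b n ρ)) (faces σ))
           (ev-xor (λ ρ → ev c (prism (a ∷_) (b ∷_) ρ)) (λ ρ → ev c (column b n ρ)) (faces σ))) ⟨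
    δ (λ ρ → ev c (column a (suc n) ρ)) σ xor (x xor z) ∎
    where
    open ≡-Reasoning
    open xor-∧-Solver using (solve; _:=_; _:+_)
    b = 1ℤ ℤ.+ a
    p = δ (λ ρ → ev c (prism (a ∷_) (b ∷_) ρ)) σ
    q = δ (λ ρ → ev c (column b n ρ)) σ
    x = c (map (a ∷_) σ)
    y = c (map (b ∷_) σ)
    z = c (map (a ℤ.+ + suc n ∷_) σ)
    shift : ∀ a n → (1ℤ ℤ.+ a) ℤ.+ n ≡ a ℤ.+ (1ℤ ℤ.+ n)
    shift = solve-∀

  δ-tower : ∀ a n z → ev (δ c) (tower a n z) ≡
            ev (δ (λ ρ → ev c (column a n ρ))) z xor (ev c (at a z) xor ev c (at (a ℤ.+ + n) z))
  δ-tower a n z = begin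
    ev (δ c) (tower a n z)
      ≡⟨ ev-concatMap (δ c) (column a n) z ⟩
    ev (λ σ → ev (δ c) (column a n σ)) z
      ≡⟨ ev-cong (δ-column a n) z ⟩
    ev (λ σ → δ (λ ρ → ev c (column a n ρ)) σ xor (c (map (a ∷_) σ) xor c (map (a ℤ.+ + n ∷_) σ))) z
      ≡⟨ ev-xor (δ (λ ρ → ev c (column a n ρ))) _ z ⟩
    ev (δ (λ ρ → ev c (column a n ρ))) z xor ev (λ σ → c (map (a ∷_) σ) xor c (map (a ℤ.+ + n ∷_) σ)) z
      ≡⟨ cong (ev (δ (λ ρ → ev c (column a n ρ))) z xor_)
              (≡.trans (ev-xor (c ∘ map (a ∷_)) (c ∘ map (a ℤ.+ + n ∷_)) z)
                       (sym (cong₂ _xor_ (ev-at a z) (ev-at (a ℤ.+ + n) z)))) ⟩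
    ev (δ (λ ρ → ev c (column a n ρ))) z xor (ev c (at a z) xor ev c (at (a ℤ.+ + n) z)) ∎
    where open ≡-Reasoning

  column-+ : ∀ a m n σ → ev c (column a (m ℕ.+ n) σ) ≡ ev c (column a m σ) xor ev c (column (a ℤ.+ + m) n σ)
  column-+ a zero    n σ = cong (λ b → ev c (column b n σ)) (sym (ℤₚ.+-identityʳ a))
  column-+ a (suc m) n σ = begin
    ev c (prism (a ∷_) (b ∷_) σ ++ column b (m ℕ.+ n) σ)
      ≡⟨ ev-++ c (prism (a ∷_) (b ∷_) σ) (column b (m ℕ.+ n) σ) ⟩
    p xor ev c (column b (m ℕ.+ n) σ)
      ≡⟨ cong (p xor_) (column-+ b m n σ) ⟩
    p xor (ev c (column b m σ) xor ev c (column (b ℤ.+ + m) n σ))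
      ≡⟨ xor-assoc p _ _ ⟨
    (p xor ev c (column b m σ)) xor ev c (column (b ℤ.+ + m) n σ)
      ≡⟨ cong₂ (λ x e → x xor ev c (column e n σ)) (ev-++ c (prism (a ∷_) (b ∷_) σ) (column b m σ)) (sym (shift a (+ m))) ⟨
    ev c (column a (suc m) σ) xor ev c (column (a ℤ.+ + suc m) n σ) ∎
    where
    open ≡-Reasoning
    b = 1ℤ ℤ.+ a
    p = ev c (prism (a ∷_) (b ∷_) σ)
    shift : ∀ a n → (1ℤ ℤ.+ a) ℤ.+ n ≡ a ℤ.+ (1ℤ ℤ.+ n)
    shift = solve-∀

∂-box : (as : Point d) (n : ℕ) (c : List (Point d) → Bool) → ev (δ c) (box as n) ≡ ev c (shell as n)
∂-box []       n c = cong (_xor false) (xor-identityʳ (c []))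
∂-box (a ∷ as) n c = begin
  ev (δ c) (tower a n (box as n))
    ≡⟨ δ-tower c a n (box as n) ⟩
  ev (δ (λ ρ → ev c (column a n ρ))) (box as n) xor (x xor y)
    ≡⟨ cong (_xor (x xor y)) (≡.trans (∂-box as n (λ ρ → ev c (column a n ρ))) (sym (ev-tower c a n (shell as n)))) ⟩
  ev c (tower a n (shell as n)) xor (x xor y)
    ≡⟨ solve 3 (λ t x y → (t :+ (x :+ y)) := (x :+ (y :+ t))) refl (ev c (tower a n (shell as n))) x y ⟩
  x xor (y xor ev c (tower a n (shell as n)))
    ≡⟨ ≡.trans (ev-++ c (at a (box as n)) _) (cong (x xor_) (ev-++ c (at (a ℤ.+ + n) (box as n)) _)) ⟨
  ev c (shell (a ∷ as) n) ∎
  where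
  open ≡-Reasoning
  open xor-∧-Solver using (solve; _:=_; _:+_)
  x = ev c (at a (box as n))
  y = ev c (at (a ℤ.+ + n) (box as n))

∂-at-box : (b : ℤ) (as : Point d) (n : ℕ) (c : List (Point (suc d)) → Bool) →
           ev (δ c) (at b (box as n)) ≡ ev c (at b (shell as n))
∂-at-box b as n c = begin
  ev (δ c) (at b (box as n))               ≡⟨ ev-at (δ c) b (box as n) ⟩
  ev (δ c ∘ map (b ∷_)) (box as n)         ≡⟨ ev-cong (δ-map (b ∷_) c) (box as n) ⟩
  ev (δ (c ∘ map (b ∷_))) (box as n)       ≡⟨ ∂-box as n (c ∘ map (b ∷_)) ⟩
  ev (c ∘ map (b ∷_)) (shell as n)         ≡⟨ ev-at c b (shell as n) ⟨
  ev c (at b (shell as n))                 ∎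
  where open ≡-Reasoning

∂-shell : (as : Point d) (n : ℕ) (c : List (Point d) → Bool) → ev (δ c) (shell as n) ≡ false
∂-shell []       n c = refl
∂-shell (a ∷ as) n c = begin
  ev (δ c) (shell (a ∷ as) n)
    ≡⟨ ≡.trans (ev-++ (δ c) (at a (box as n)) _)
               (cong (ev (δ c) (at a (box as n)) xor_) (ev-++ (δ c) (at (a ℤ.+ + n) (box as n)) _)) ⟩
  ev (δ c) (at a (box as n)) xor (ev (δ c) (at (a ℤ.+ + n) (box as n)) xor ev (δ c) (tower a n (shell as n)))
    ≡⟨ cong₂ _xor_ (∂-at-box a as n c) (cong₂ _xor_ (∂-at-box (a ℤ.+ + n) as n c) (δ-tower c a n (shell as n))) ⟩
  x xor (y xor (ev (δ (λ ρ → ev c (column a n ρ))) (shell as n) xor (x xor y)))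
    ≡⟨ cong (λ e → x xor (y xor (e xor (x xor y)))) (∂-shell as n (λ ρ → ev c (column a n ρ))) ⟩
  x xor (y xor (x xor y))
    ≡⟨ ≡.trans (sym (xor-assoc x y (x xor y))) (xor-same (x xor y)) ⟩
  false ∎
  where
  open ≡-Reasoning
  x = ev c (at a (shell as n))
  y = ev c (at (a ℤ.+ + n) (shell as n))

-- Antipodal symmetry and hemispheres

neg : Point d → Point d
neg = Vec.map (ℤ.-_)

neg-involutive : (v : Point d) → neg (neg v) ≡ v
neg-involutive []      = refl
neg-involutive (a ∷ v) = cong₂ _∷_ (ℤₚ.neg-involutive a) (neg-involutive v)

-- The order of the vertices is reversed so that the triangulations are preserved.
antipode : List (Point d) → List (Point d)
antipode = reverse ∘ map neg

antipode-map-∷ : (a : ℤ) (σ : List (Point d)) → antipode (map (a ∷_) σ) ≡ map (ℤ.- a ∷_) (antipode σ)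
antipode-map-∷ a σ = begin
  reverse (map neg (map (a ∷_) σ))        ≡⟨ cong reverse (Listₚ.map-∘ σ) ⟨
  reverse (map (λ v → ℤ.- a ∷ neg v) σ)   ≡⟨ cong reverse (Listₚ.map-∘ σ) ⟩
  reverse (map (ℤ.- a ∷_) (map neg σ))    ≡⟨ Listₚ.reverse-map (ℤ.- a ∷_) (map neg σ) ⟨
  map (ℤ.- a ∷_) (antipode σ)             ∎
  where open ≡-Reasoning

module _ (c : List (Point (suc d)) → Bool) where

  prism-antipode : ∀ a σ → ev c (prism (a ∷_) (1ℤ ℤ.+ a ∷_) (antipode σ)) ≡
                   ev (c ∘ antipode) (prism (ℤ.- (1ℤ ℤ.+ a) ∷_) (1ℤ ℤ.+ ℤ.- (1ℤ ℤ.+ a) ∷_) σ)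
  prism-antipode a σ = begin
    ev c (prism (a ∷_) (1ℤ ℤ.+ a ∷_) (reverse (map neg σ)))
      ≡⟨ prism-reverse (a ∷_) (1ℤ ℤ.+ a ∷_) c (map neg σ) ⟩
    ev (c ∘ reverse) (prism (1ℤ ℤ.+ a ∷_) (a ∷_) (map neg σ))
      ≡⟨ cong (ev (c ∘ reverse)) (prism-map (1ℤ ℤ.+ a ∷_) (a ∷_) neg σ) ⟩
    ev (c ∘ reverse) (prism (λ v → 1ℤ ℤ.+ a ∷ neg v) (λ v → a ∷ neg v) σ)
      ≡⟨ cong (ev (c ∘ reverse)) (prism-cong (λ v → cong (_∷ neg v) (ℤₚ.neg-involutive (1ℤ ℤ.+ a)))
                                             (λ v → cong (_∷ neg v) (e a)) σ) ⟨
    ev (c ∘ reverse) (prism (neg ∘ (ℤ.- (1ℤ ℤ.+ a) ∷_)) (neg ∘ (1ℤ ℤ.+ ℤ.- (1ℤ ℤ.+ a) ∷_)) σ)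
      ≡⟨ cong (ev (c ∘ reverse)) (map-prism neg (ℤ.- (1ℤ ℤ.+ a) ∷_) (1ℤ ℤ.+ ℤ.- (1ℤ ℤ.+ a) ∷_) σ) ⟨
    ev (c ∘ reverse) (map (map neg) (prism (ℤ.- (1ℤ ℤ.+ a) ∷_) (1ℤ ℤ.+ ℤ.- (1ℤ ℤ.+ a) ∷_) σ))
      ≡⟨ ev-map (c ∘ reverse) (map neg) (prism (ℤ.- (1ℤ ℤ.+ a) ∷_) (1ℤ ℤ.+ ℤ.- (1ℤ ℤ.+ a) ∷_) σ) ⟩
    ev (c ∘ antipode) (prism (ℤ.- (1ℤ ℤ.+ a) ∷_) (1ℤ ℤ.+ ℤ.- (1ℤ ℤ.+ a) ∷_) σ) ∎
    where
    open ≡-Reasoning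
    e : ∀ a → ℤ.- (1ℤ ℤ.+ ℤ.- (1ℤ ℤ.+ a)) ≡ a
    e = solve-∀

  -- Negation turns the interval around: the first prism of one column corresponds to the last prism
  -- of the other, which `column-+` splits off.
  column-antipode′ : ∀ a n σ → ev c (column a n (antipode σ)) ≡ ev (c ∘ antipode) (column (ℤ.- (a ℤ.+ + n)) n σ)
  column-antipode′ a zero    σ = refl
  column-antipode′ a (suc n) σ = begin
    ev c (prism (a ∷_) (1ℤ ℤ.+ a ∷_) (antipode σ) ++ column (1ℤ ℤ.+ a) n (antipode σ))
      ≡⟨ ev-++ c (prism (a ∷_) (1ℤ ℤ.+ a ∷_) (antipode σ)) _ ⟩
    ev c (prism (a ∷_) (1ℤ ℤ.+ a ∷_) (antipode σ)) xor ev c (column (1ℤ ℤ.+ a) n (antipode σ))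
      ≡⟨ cong₂ _xor_ (≡.trans (prism-antipode a σ) (sym one)) (column-antipode′ (1ℤ ℤ.+ a) n σ) ⟩
    ev (c ∘ antipode) (column (ℤ.- (1ℤ ℤ.+ a)) 1 σ) xor ev (c ∘ antipode) (column (ℤ.- (1ℤ ℤ.+ a ℤ.+ + n)) n σ)
      ≡⟨ xor-comm (ev (c ∘ antipode) (column (ℤ.- (1ℤ ℤ.+ a)) 1 σ)) _ ⟩
    ev (c ∘ antipode) (column (ℤ.- (1ℤ ℤ.+ a ℤ.+ + n)) n σ) xor ev (c ∘ antipode) (column (ℤ.- (1ℤ ℤ.+ a)) 1 σ)
      ≡⟨ cong₂ (λ x y → ev (c ∘ antipode) (column x n σ) xor ev (c ∘ antipode) (column y 1 σ))
               (e₁ a (+ n)) (e₂ a (+ n)) ⟩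
    ev (c ∘ antipode) (column b n σ) xor ev (c ∘ antipode) (column (b ℤ.+ + n) 1 σ)
      ≡⟨ column-+ (c ∘ antipode) b n 1 σ ⟨
    ev (c ∘ antipode) (column b (n ℕ.+ 1) σ)
      ≡⟨ cong (λ m → ev (c ∘ antipode) (column b m σ)) (ℕₚ.+-comm n 1) ⟩
    ev (c ∘ antipode) (column b (suc n) σ) ∎
    where
    open ≡-Reasoning
    b = ℤ.- (a ℤ.+ + suc n)
    e₁ : ∀ a n → ℤ.- (1ℤ ℤ.+ a ℤ.+ n) ≡ ℤ.- (a ℤ.+ (1ℤ ℤ.+ n))
    e₁ = solve-∀
    e₂ : ∀ a n → ℤ.- (1ℤ ℤ.+ a) ≡ ℤ.- (a ℤ.+ (1ℤ ℤ.+ n)) ℤ.+ n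
    e₂ = solve-∀
    one : ev (c ∘ antipode) (column (ℤ.- (1ℤ ℤ.+ a)) 1 σ) ≡
          ev (c ∘ antipode) (prism (ℤ.- (1ℤ ℤ.+ a) ∷_) (1ℤ ℤ.+ ℤ.- (1ℤ ℤ.+ a) ∷_) σ)
    one = cong (ev (c ∘ antipode)) (Listₚ.++-identityʳ (prism (ℤ.- (1ℤ ℤ.+ a) ∷_) (1ℤ ℤ.+ ℤ.- (1ℤ ℤ.+ a) ∷_) σ))

  column-antipode : ∀ a b n σ → ℤ.- (a ℤ.+ + n) ≡ b →
                    ev (c ∘ antipode) (column b n σ) ≡ ev c (column a n (antipode σ))
  column-antipode a b n σ refl = sym (column-antipode′ a n σ)

module _ (M : ℕ) where

  corner : ∀ d → Point d
  corner d = replicate d (ℤ.- + M)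

  ball sphere : ∀ d → Chain (Point d)
  ball d   = box (corner d) (M ℕ.+ M)
  sphere d = shell (corner d) (M ℕ.+ M)

  hemisphere : ∀ d → Chain (Point (suc d))
  hemisphere d = at (+ M) (ball d) ++ tower 0ℤ M (sphere d)

  corner-top : (ℤ.- + M) ℤ.+ + (M ℕ.+ M) ≡ + M
  corner-top = ≡.trans (cong (λ b → (ℤ.- + M) ℤ.+ b) (ℤₚ.pos-+ M M)) (e (+ M))
    where
    e : ∀ a → (ℤ.- a) ℤ.+ (a ℤ.+ a) ≡ a
    e = solve-∀

  ball-antipode : ∀ d c → ev (c ∘ antipode) (ball d) ≡ ev c (ball d)
  ball-antipode zero    c = refl
  ball-antipode (suc d) c = begin
    ev (c ∘ antipode) (ball (suc d))
      ≡⟨ ev-tower (c ∘ antipode) (ℤ.- + M) (M ℕ.+ M) (ball d) ⟩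
    ev (λ σ → ev (c ∘ antipode) (column (ℤ.- + M) (M ℕ.+ M) σ)) (ball d)
      ≡⟨ ev-cong (λ σ → column-antipode c (ℤ.- + M) (ℤ.- + M) (M ℕ.+ M) σ (cong ℤ.-_ corner-top)) (ball d) ⟩
    ev ((λ ρ → ev c (column (ℤ.- + M) (M ℕ.+ M) ρ)) ∘ antipode) (ball d)
      ≡⟨ ball-antipode d (λ ρ → ev c (column (ℤ.- + M) (M ℕ.+ M) ρ)) ⟩
    ev (λ ρ → ev c (column (ℤ.- + M) (M ℕ.+ M) ρ)) (ball d)
      ≡⟨ ev-tower c (ℤ.- + M) (M ℕ.+ M) (ball d) ⟨
    ev c (ball (suc d)) ∎
    where open ≡-Reasoning

  ball-at-antipode : ∀ d c a b → ℤ.- a ≡ b → ev (c ∘ antipode) (at a (ball d)) ≡ ev c (at b (ball d))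
  ball-at-antipode d c a b refl = begin
    ev (c ∘ antipode) (at a (ball d))
      ≡⟨ ev-at (c ∘ antipode) a (ball d) ⟩
    ev (c ∘ antipode ∘ map (a ∷_)) (ball d)
      ≡⟨ ev-cong (λ σ → cong c (antipode-map-∷ a σ)) (ball d) ⟩
    ev (c ∘ map (ℤ.- a ∷_) ∘ antipode) (ball d)
      ≡⟨ ball-antipode d (c ∘ map (ℤ.- a ∷_)) ⟩
    ev (c ∘ map (ℤ.- a ∷_)) (ball d)
      ≡⟨ ev-at c (ℤ.- a) (ball d) ⟨
    ev c (at (ℤ.- a) (ball d)) ∎
    where open ≡-Reasoning

  ev-sphere : ∀ d c → ev c (sphere (suc d)) ≡
              ev c (at (ℤ.- + M) (ball d)) xor (ev c (at (+ M) (ball d)) xor ev c (tower (ℤ.- + M) (M ℕ.+ M) (sphere d)))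
  ev-sphere d c = begin
    ev c (sphere (suc d))
      ≡⟨ ≡.trans (ev-++ c (at (ℤ.- + M) (ball d)) _)
                 (cong (ev c (at (ℤ.- + M) (ball d)) xor_) (ev-++ c (at ((ℤ.- + M) ℤ.+ + (M ℕ.+ M)) (ball d)) _)) ⟩
    ev c (at (ℤ.- + M) (ball d)) xor (ev c (at ((ℤ.- + M) ℤ.+ + (M ℕ.+ M)) (ball d)) xor t)
      ≡⟨ cong (λ b → ev c (at (ℤ.- + M) (ball d)) xor (ev c (at b (ball d)) xor t)) corner-top ⟩
    ev c (at (ℤ.- + M) (ball d)) xor (ev c (at (+ M) (ball d)) xor t) ∎
    where
    open ≡-Reasoning
    t = ev c (tower (ℤ.- + M) (M ℕ.+ M) (sphere d))

  sphere-antipode : ∀ d c → ev (c ∘ antipode) (sphere d) ≡ ev c (sphere d)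
  sphere-antipode zero    c = refl
  sphere-antipode (suc d) c = begin
    ev (c ∘ antipode) (sphere (suc d))
      ≡⟨ ev-sphere d (c ∘ antipode) ⟩
    ev (c ∘ antipode) (at (ℤ.- + M) (ball d)) xor (ev (c ∘ antipode) (at (+ M) (ball d)) xor
      ev (c ∘ antipode) (tower (ℤ.- + M) (M ℕ.+ M) (sphere d)))
      ≡⟨ cong₂ _xor_ (ball-at-antipode d c _ (+ M) (ℤₚ.neg-involutive (+ M)))
                     (cong₂ _xor_ (ball-at-antipode d c _ (ℤ.- + M) refl) towers) ⟩
    x xor (y xor t)
      ≡⟨ solve 3 (λ x y t → (x :+ (y :+ t)) := (y :+ (x :+ t))) refl x y t ⟩
    y xor (x xor t)
      ≡⟨ ev-sphere d c ⟨
    ev c (sphere (suc d)) ∎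
    where
    open ≡-Reasoning
    open xor-∧-Solver using (solve; _:=_; _:+_)
    x = ev c (at (+ M) (ball d))
    y = ev c (at (ℤ.- + M) (ball d))
    t = ev c (tower (ℤ.- + M) (M ℕ.+ M) (sphere d))
    towers : ev (c ∘ antipode) (tower (ℤ.- + M) (M ℕ.+ M) (sphere d)) ≡ t
    towers = begin
      ev (c ∘ antipode) (tower (ℤ.- + M) (M ℕ.+ M) (sphere d))
        ≡⟨ ev-tower (c ∘ antipode) (ℤ.- + M) (M ℕ.+ M) (sphere d) ⟩
      ev (λ σ → ev (c ∘ antipode) (column (ℤ.- + M) (M ℕ.+ M) σ)) (sphere d)
        ≡⟨ ev-cong (λ σ → column-antipode c (ℤ.- + M) (ℤ.- + M) (M ℕ.+ M) σ (cong ℤ.-_ corner-top)) (sphere d) ⟩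
      ev ((λ ρ → ev c (column (ℤ.- + M) (M ℕ.+ M) ρ)) ∘ antipode) (sphere d)
        ≡⟨ sphere-antipode d (λ ρ → ev c (column (ℤ.- + M) (M ℕ.+ M) ρ)) ⟩
      ev (λ ρ → ev c (column (ℤ.- + M) (M ℕ.+ M) ρ)) (sphere d)
        ≡⟨ ev-tower c (ℤ.- + M) (M ℕ.+ M) (sphere d) ⟨
      t ∎

  -- The tower is cut at height 0. Its lower half is the antipodal image of its upper half because
  -- the triangulations of the ball and of the smaller sphere are themselves symmetric.
  sphere-hemispheres : ∀ d c → ev c (sphere (suc d)) ≡ ev c (hemisphere d) xor ev (c ∘ antipode) (hemisphere d)
  sphere-hemispheres d c = begin
    ev c (sphere (suc d))
      ≡⟨ ev-sphere d c ⟩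
    y xor (x xor ev c (tower (ℤ.- + M) (M ℕ.+ M) (sphere d)))
      ≡⟨ cong (λ e → y xor (x xor e)) towers ⟩
    y xor (x xor (s xor t))
      ≡⟨ solve 4 (λ x y s t → (y :+ (x :+ (s :+ t))) := ((x :+ t) :+ (y :+ s))) refl x y s t ⟩
    (x xor t) xor (y xor s)
      ≡⟨ cong₂ _xor_ (ev-++ c (at (+ M) (ball d)) (tower 0ℤ M (sphere d)))
           (≡.trans (ev-++ (c ∘ antipode) (at (+ M) (ball d)) (tower 0ℤ M (sphere d)))
                    (cong₂ _xor_ (ball-at-antipode d c (+ M) (ℤ.- + M) refl) lower)) ⟨
    ev c (hemisphere d) xor ev (c ∘ antipode) (hemisphere d) ∎
    where
    open ≡-Reasoning
    open xor-∧-Solver using (solve; _:=_; _:+_)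
    x = ev c (at (+ M) (ball d))
    y = ev c (at (ℤ.- + M) (ball d))
    s = ev c (tower (ℤ.- + M) M (sphere d))
    t = ev c (tower 0ℤ M (sphere d))
    towers : ev c (tower (ℤ.- + M) (M ℕ.+ M) (sphere d)) ≡ s xor t
    towers = begin
      ev c (tower (ℤ.- + M) (M ℕ.+ M) (sphere d))
        ≡⟨ ev-tower c (ℤ.- + M) (M ℕ.+ M) (sphere d) ⟩
      ev (λ σ → ev c (column (ℤ.- + M) (M ℕ.+ M) σ)) (sphere d)
        ≡⟨ ev-cong (λ σ → ≡.trans (column-+ c (ℤ.- + M) M M σ)
             (cong (λ b → ev c (column (ℤ.- + M) M σ) xor ev c (column b M σ)) (ℤₚ.+-inverseˡ (+ M)))) (sphere d) ⟩
      ev (λ σ → ev c (column (ℤ.- + M) M σ) xor ev c (column 0ℤ M σ)) (sphere d)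
        ≡⟨ ev-xor (λ σ → ev c (column (ℤ.- + M) M σ)) (λ σ → ev c (column 0ℤ M σ)) (sphere d) ⟩
      ev (λ σ → ev c (column (ℤ.- + M) M σ)) (sphere d) xor ev (λ σ → ev c (column 0ℤ M σ)) (sphere d)
        ≡⟨ cong₂ _xor_ (ev-tower c (ℤ.- + M) M (sphere d)) (ev-tower c 0ℤ M (sphere d)) ⟨
      s xor t ∎
    lower : ev (c ∘ antipode) (tower 0ℤ M (sphere d)) ≡ s
    lower = begin
      ev (c ∘ antipode) (tower 0ℤ M (sphere d))
        ≡⟨ ev-tower (c ∘ antipode) 0ℤ M (sphere d) ⟩
      ev (λ σ → ev (c ∘ antipode) (column 0ℤ M σ)) (sphere d)
        ≡⟨ ev-cong (λ σ → column-antipode c (ℤ.- + M) 0ℤ M σ (cong ℤ.-_ (ℤₚ.+-inverseˡ (+ M)))) (sphere d) ⟩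
      ev ((λ ρ → ev c (column (ℤ.- + M) M ρ)) ∘ antipode) (sphere d)
        ≡⟨ sphere-antipode d (λ ρ → ev c (column (ℤ.- + M) M ρ)) ⟩
      ev (λ ρ → ev c (column (ℤ.- + M) M ρ)) (sphere d)
        ≡⟨ ev-tower c (ℤ.- + M) M (sphere d) ⟨
      s ∎

  -- The sphere is a cycle, so nothing but the bottom and the top of the tower survives.
  δ-tower-sphere : ∀ d c → ev (δ c) (tower 0ℤ M (sphere d)) ≡ ev c (at 0ℤ (sphere d)) xor ev c (at (+ M) (sphere d))
  δ-tower-sphere d c = ≡.trans (δ-tower c 0ℤ M (sphere d))
    (cong₂ _xor_ (∂-shell (corner d) (M ℕ.+ M) (λ ρ → ev c (column 0ℤ M ρ)))
                 (cong (λ b → ev c (at 0ℤ (sphere d)) xor ev c (at b (sphere d))) (ℤₚ.+-identityˡ (+ M))))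

  ∂-hemisphere : ∀ d c → ev (δ c) (hemisphere d) ≡ ev c (at 0ℤ (sphere d))
  ∂-hemisphere d c = begin
    ev (δ c) (hemisphere d)
      ≡⟨ ev-++ (δ c) (at (+ M) (ball d)) (tower 0ℤ M (sphere d)) ⟩
    ev (δ c) (at (+ M) (ball d)) xor ev (δ c) (tower 0ℤ M (sphere d))
      ≡⟨ cong₂ _xor_ (∂-at-box (+ M) (corner d) (M ℕ.+ M) c) (δ-tower-sphere d c) ⟩
    y xor (x xor y)
      ≡⟨ solve 2 (λ x y → (y :+ (x :+ y)) := (x :+ (y :+ y))) refl x y ⟩
    x xor (y xor y)
      ≡⟨ ≡.trans (cong (x xor_) (xor-same y)) (xor-identityʳ x) ⟩
    x ∎
    where
    open ≡-Reasoning
    open xor-∧-Solver using (solve; _:=_; _:+_)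
    x = ev c (at 0ℤ (sphere d))
    y = ev c (at (+ M) (sphere d))

-- Steps, facets and vertex counts of the simplices

Step₁ : ℤ → ℤ → Set
Step₁ a b = b ≡ a ⊎ b ≡ 1ℤ ℤ.+ a

Step : Point d → Point d → Set
Step = Pointwise Step₁

Step-refl : (v : Point d) → Step v v
Step-refl v = PW.refl (inj₁ refl)

Facet : Point d → ℕ → List (Point d) → Set
Facet {d} as n σ = Σ (Fin d) λ i →
  All (λ v → lookup v i ≡ lookup as i) σ ⊎ All (λ v → lookup v i ≡ lookup as i ℤ.+ + n) σ

All-concatMap : {X Y : Set} {P : X → Set} {Q : Y → Set} {h : X → List Y} →
                (∀ {x} → P x → All Q (h x)) → ∀ {z} → All P z → All Q (concatMap h z)
All-concatMap f []       = []
All-concatMap f (p ∷ ps) = Allₚ.++⁺ (f p) (All-concatMap f ps)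

All-concatMap-universal : {X Y : Set} {Q : Y → Set} {h : X → List Y} →
                          (∀ x → All Q (h x)) → ∀ z → All Q (concatMap h z)
All-concatMap-universal f []      = []
All-concatMap-universal f (x ∷ z) = Allₚ.++⁺ (f x) (All-concatMap-universal f z)

All-column : {P : List (Point (suc d)) → Set} {σ : List (Point d)} →
             (∀ a → All P (prism (a ∷_) (1ℤ ℤ.+ a ∷_) σ)) → ∀ a n → All P (column a n σ)
All-column f a zero    = []
All-column f a (suc n) = Allₚ.++⁺ (f a) (All-column f (1ℤ ℤ.+ a) n)

column-Step : {σ : List (Point d)} → AllPairs Step σ → ∀ a n → All (AllPairs Step) (column a n σ)
column-Step p = All-column λ a → prism-AllPairs (inj₁ refl ∷_) (inj₂ refl ∷_) (inj₁ refl ∷_)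
  (All.universal (λ v → inj₂ refl ∷ Step-refl v) _) p

at-Step : {z : Chain (Point d)} → All (AllPairs Step) z → ∀ a → All (AllPairs Step) (at a z)
at-Step ps a = Allₚ.map⁺ (All.map (λ p → AllPairsₚ.map⁺ (AllPairs.map (inj₁ refl ∷_) p)) ps)

box-Step : (as : Point d) (n : ℕ) → All (AllPairs Step) (box as n)
box-Step []       n = ([] ∷ []) ∷ []
box-Step (a ∷ as) n = All-concatMap (λ p → column-Step p a n) (box-Step as n)

shell-Step : (as : Point d) (n : ℕ) → All (AllPairs Step) (shell as n)
shell-Step []       n = [] ∷ []
shell-Step (a ∷ as) n = Allₚ.++⁺ (at-Step (box-Step as n) a)
  (Allₚ.++⁺ (at-Step (box-Step as n) (a ℤ.+ + n)) (All-concatMap (λ p → column-Step p a n) (shell-Step as n)))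

column-length : {m : ℕ} {σ : List (Point d)} → length σ ≡ m → ∀ a n → All (λ ρ → length ρ ≡ suc m) (column a n σ)
column-length {σ = σ} refl = All-column λ a → prism-length (a ∷_) (1ℤ ℤ.+ a ∷_) σ

at-length : {m : ℕ} {z : Chain (Point d)} → All (λ σ → length σ ≡ m) z → ∀ a → All (λ σ → length σ ≡ m) (at a z)
at-length ps a = Allₚ.map⁺ (All.map (λ {σ} → ≡.trans (Listₚ.length-map (a ∷_) σ)) ps)

box-length : (as : Point d) (n : ℕ) → All (λ σ → length σ ≡ suc d) (box as n)
box-length []       n = refl ∷ []
box-length (a ∷ as) n = All-concatMap (λ p → column-length p a n) (box-length as n)

shell-length : (as : Point d) (n : ℕ) → All (λ σ → length σ ≡ d) (shell as n)
shell-length []       n = refl ∷ []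
shell-length (a ∷ as) n = Allₚ.++⁺ (at-length (box-length as n) a)
  (Allₚ.++⁺ (at-length (box-length as n) (a ℤ.+ + n)) (All-concatMap (λ p → column-length p a n) (shell-length as n)))

column-Facet : {as : Point d} {n : ℕ} {σ : List (Point d)} → Facet as n σ →
               ∀ a b m → All (Facet (b ∷ as) n) (column a m σ)
column-Facet (i , inj₁ p) a b m = All.map (λ q → suc i , inj₁ q) (All-column (λ a → prism-All (λ x → x) (λ x → x) p) a m)
column-Facet (i , inj₂ p) a b m = All.map (λ q → suc i , inj₂ q) (All-column (λ a → prism-All (λ x → x) (λ x → x) p) a m)

shell-Facet : (as : Point (suc d)) (n : ℕ) → All (Facet as n) (shell as n)
shell-Facet (a ∷ as) n = Allₚ.++⁺ (Allₚ.map⁺ (All.universal (λ σ → zero , inj₁ (Allₚ.map⁺ (All.universal (λ _ → refl) σ))) (box as n)))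
  (Allₚ.++⁺ (Allₚ.map⁺ (All.universal (λ σ → zero , inj₂ (Allₚ.map⁺ (All.universal (λ _ → refl) σ))) (box as n))) (towers as))
  where
  towers : ∀ {d} (as : Point d) → All (Facet (a ∷ as) n) (tower a n (shell as n))
  towers []         = Allₚ.++⁺ (All-column (λ _ → []) a n) []
  towers (a′ ∷ as) = All-concatMap (λ p → column-Facet p a a n) (shell-Facet (a′ ∷ as) n)

-- Alternating simplices over a sphere

Apart : ℕ → ℕ → Set
Apart x y = y ≢ flip x

flip-irreflexive : ∀ x → x ≢ flip x
flip-irreflexive 0 ()
flip-irreflexive 1 ()
flip-irreflexive (suc (suc x)) e = flip-irreflexive x (ℕₚ.suc-injective (ℕₚ.suc-injective e))

AllPairs-Proper : ∀ {w} → AllPairs Apart w → Proper w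
AllPairs-Proper (p ∷ ps) {x} (here refl) (here e)  = flip-irreflexive x (sym e)
AllPairs-Proper (p ∷ ps)     (here refl) (there j) = All.lookup p j refl
AllPairs-Proper (p ∷ ps) {x} (there i)   (here refl) = All.lookup p i (sym (flip-involutive x))
AllPairs-Proper (p ∷ ps)     (there i)   (there j) = AllPairs-Proper ps i j

signs-differ : ∀ {x y} → sgn x ≡ false → sgn y ≡ true → x ≢ y
signs-differ p q refl with () ← ≡.trans (sym p) q

minus-minus : ∀ a b → Apart (minus a) (minus b)
minus-minus a b e = signs-differ (sgn-minus b) (sgn-plus a) (≡.trans e (flip-minus a))

plus-plus : ∀ a b → Apart (plus a) (plus b)
plus-plus a b e = signs-differ (sgn-minus a) (sgn-plus b) (sym (≡.trans e (flip-plus a)))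

minus-plus : ∀ {a b} → b ≢ a → Apart (minus a) (plus b)
minus-plus {a} {b} ne e = ne (≡.trans (sym (colour-plus b)) (≡.trans (cong ⌊_/2⌋ (≡.trans e (flip-minus a))) (colour-plus a)))

zip-AllPairs : {R Q : A → A → Set} {P : A → Set} → (∀ {v u} → R v u → P v → P u → Q v u) →
               {σ : List A} → AllPairs R σ → All P σ → AllPairs Q σ
zip-AllPairs f []       []       = []
zip-AllPairs f (r ∷ rs) (p ∷ ps) = All.zipWith (λ (x , y) → f x p y) (r , ps) ∷ zip-AllPairs f rs ps

lower upper : (Point d → ℕ) → Point d → ℕ
lower f v = minus (f (neg v))
upper f v = plus (f v)

alternation : Bool → (Point d → ℕ) → List (Point d) → Bool
alternation s f σ = ev (alt s) (prism (lower f) (upper f) σ)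

-- The lower label at v is the flip of the upper label at -v. Passing to the antipode therefore
-- flips every label and turns the prism upside down, and flipping changes the sign with which an
-- alternation starts.
alternation-antipode : (f : Point d → ℕ) (σ : List (Point d)) → All Proper (prism (lower f) (upper f) σ) →
                       alternation true f (antipode σ) ≡ alternation false f σ
alternation-antipode f σ pr = begin
  ev (alt true) (prism (lower f) (upper f) (reverse (map neg σ)))
    ≡⟨ prism-reverse (lower f) (upper f) (alt true) (map neg σ) ⟩
  ev (alt true ∘ reverse) (prism (upper f) (lower f) (map neg σ))
    ≡⟨ ev-cong (λ w → alt-cong true (↭ₚ.↭-reverse w)) (prism (upper f) (lower f) (map neg σ)) ⟩
  ev (alt true) (prism (upper f) (lower f) (map neg σ))
    ≡⟨ cong (ev (alt true)) (prism-map (upper f) (lower f) neg σ) ⟩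
  ev (alt true) (prism (upper f ∘ neg) (lower f ∘ neg) σ)
    ≡⟨ cong (ev (alt true)) (prism-cong (λ v → flip-minus (f (neg v)))
         (λ v → ≡.trans (flip-plus (f v)) (cong (minus ∘ f) (sym (neg-involutive v)))) σ) ⟨
  ev (alt true) (prism (flip ∘ lower f) (flip ∘ upper f) σ)
    ≡⟨ cong (ev (alt true)) (map-prism flip (lower f) (upper f) σ) ⟨
  ev (alt true) (map (map flip) (prism (lower f) (upper f) σ))
    ≡⟨ ev-map (alt true) (map flip) (prism (lower f) (upper f) σ) ⟩
  ev (alt true ∘ map flip) (prism (lower f) (upper f) σ)
    ≡⟨ ev-cong-All (All.map (λ {w} → alt-flip true w) pr) ⟩
  ev (alt false) (prism (lower f) (upper f) σ) ∎
  where open ≡-Reasoning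

-- By the homotopy formula the difference lies in the bottom and the top of the prism. Each of these
-- carries a single sign and so, with two letters or more, does not alternate.
alternation-δ : (f : Point d → ℕ) (σ : List (Point d)) → 2 ℕ.≤ length σ →
                alternation true f σ xor alternation false f σ ≡ δ (alternation true f) σ
alternation-δ f σ len = begin
  alternation true f σ xor alternation false f σ
    ≡⟨ ev-xor (alt true) (alt false) words ⟨
  ev (λ w → alt true w xor alt false w) words
    ≡⟨ ev-cong (δ-alt true) words ⟨
  ev (δ (alt true)) words
    ≡⟨ δ-prism (lower f) (upper f) (alt true) σ ⟩
  δ (alternation true f) σ xor (alt true (map (lower f) σ) xor alt true (map (upper f) σ))
    ≡⟨ cong (δ (alternation true f) σ xor_) (cong₂ _xor_
         (alt-constant false (Allₚ.map⁺ (All.universal (λ v → sgn-minus (f (neg v))) σ))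
                       (subst (2 ℕ.≤_) (sym (Listₚ.length-map (lower f) σ)) len) true)
         (alt-constant true (Allₚ.map⁺ (All.universal (λ v → sgn-plus (f v)) σ))
                       (subst (2 ℕ.≤_) (sym (Listₚ.length-map (upper f) σ)) len) true)) ⟩
  δ (alternation true f) σ xor false
    ≡⟨ xor-identityʳ _ ⟩
  δ (alternation true f) σ ∎
  where
  open ≡-Reasoning
  words = prism (lower f) (upper f) σ

alt-singleton : ∀ s x → alt s (x ∷ []) ≡ eqᵇ s (sgn x) ∧ true
alt-singleton s x = cong (alternates s) (↭ₚ.↭-singleton-inv (sort-↭ (x ∷ [])))

-- Up to order the second word is the flip of the first, so the sum is `δ (alt true)` of the first.
-- Of its two one-letter faces only the positive one alternates.
alt-pair : ∀ {a b} → b ≢ a → alt true (minus a ∷ plus b ∷ []) xor alt true (minus b ∷ plus a ∷ []) ≡ true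
alt-pair {a} {b} ne = begin
  alt true w xor alt true (minus b ∷ plus a ∷ [])
    ≡⟨ cong (alt true w xor_) (alt-cong true (swap (minus b) (plus a) ↭-refl)) ⟩
  alt true w xor alt true (plus a ∷ minus b ∷ [])
    ≡⟨ cong₂ (λ x y → alt true w xor alt true (x ∷ y ∷ [])) (sym (flip-minus a)) (sym (flip-plus b)) ⟩
  alt true w xor alt true (map flip w)
    ≡⟨ cong (alt true w xor_) (alt-flip true w (AllPairs-Proper ((minus-plus ne ∷ []) ∷ [] ∷ []))) ⟩
  alt true w xor alt false w
    ≡⟨ δ-alt true w ⟨
  alt true (plus b ∷ []) xor (alt true (minus a ∷ []) xor false)
    ≡⟨ cong₂ (λ x y → x xor (y xor false)) (alt-singleton true (plus b)) (alt-singleton true (minus a)) ⟩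
  (sgn (plus b) ∧ true) xor ((sgn (minus a) ∧ true) xor false)
    ≡⟨ cong₂ (λ x y → (x ∧ true) xor ((y ∧ true) xor false)) (sgn-plus b) (sgn-minus a) ⟩
  true ∎
  where
  open ≡-Reasoning
  w = minus a ∷ plus b ∷ []

module _ (M : ℕ) where

  Extreme : ℤ → Set
  Extreme a = a ≡ ℤ.- + M ⊎ a ≡ + M

  OnWall : List (Point d) → Set
  OnWall {d} σ = Σ (Fin d) λ i → Σ ℤ λ a → Extreme a × All (λ v → lookup v i ≡ a) σ

  -- A lower and an upper label in one prism sit over vertices v, u with `Step v u`, possibly equal;
  -- on a wall these are the pairs controlled here.
  Antipodal : (Point d → ℕ) → Set
  Antipodal {d} f = ∀ {v u : Point d} i → Step v u → lookup u i ≡ lookup v i → Extreme (lookup v i) →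
                    f u ≢ f (neg v)

  sphere-OnWall : ∀ d → All OnWall (sphere M (suc d))
  sphere-OnWall d = All.map wall (shell-Facet (corner M (suc d)) (M ℕ.+ M))
    where
    wall : ∀ {σ} → Facet (corner M (suc d)) (M ℕ.+ M) σ → OnWall σ
    wall (i , inj₁ p) = i , ℤ.- + M , inj₁ refl , All.map (λ e → ≡.trans e (Vecₚ.lookup-replicate i _)) p
    wall (i , inj₂ p) = i , + M , inj₂ refl , All.map (λ e → ≡.trans e
      (≡.trans (cong (ℤ._+ + (M ℕ.+ M)) (Vecₚ.lookup-replicate i _)) (corner-top M))) p

  hemisphere-OnWall : ∀ d → All OnWall (hemisphere M (suc d))
  hemisphere-OnWall d = Allₚ.++⁺
    (Allₚ.map⁺ (All.universal (λ σ → zero , + M , inj₂ refl , Allₚ.map⁺ (All.universal (λ _ → refl) σ)) (ball M (suc d))))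
    (All-concatMap (λ { (i , a , e , p) → All.map (λ q → suc i , a , e , q)
                         (All-column (λ b → prism-All (λ x → x) (λ x → x) p) 0ℤ M) }) (sphere-OnWall d))

  hemisphere-Step : ∀ d → All (AllPairs Step) (hemisphere M d)
  hemisphere-Step d = Allₚ.++⁺ (at-Step (box-Step (corner M d) (M ℕ.+ M)) (+ M))
    (All-concatMap (λ p → column-Step p 0ℤ M) (shell-Step (corner M d) (M ℕ.+ M)))

  hemisphere-length : ∀ d → All (λ σ → length σ ≡ suc d) (hemisphere M d)
  hemisphere-length d = Allₚ.++⁺ (at-length (box-length (corner M d) (M ℕ.+ M)) (+ M))
    (All-concatMap (λ p → column-length p 0ℤ M) (shell-length (corner M d) (M ℕ.+ M)))

  module _ {d : ℕ} (f : Point d → ℕ) (f-antipodal : Antipodal f) where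

    prism-Proper : {σ : List (Point d)} → OnWall σ → AllPairs Step σ → All Proper (prism (lower f) (upper f) σ)
    prism-Proper {σ} (i , a , e , p) st = All.map AllPairs-Proper
      (prism-AllPairs (λ _ → minus-minus _ _) minus-plus (λ _ → plus-plus _ _)
        (All.map (λ {v} q → minus-plus (f-antipodal i (Step-refl v) refl (subst Extreme (sym q) e))) p)
        (zip-AllPairs {Q = λ v u → f u ≢ f (neg v)}
          (λ s q r → f-antipodal i s (≡.trans r (sym q)) (subst Extreme (sym q) e)) st p))

  alternation-sphere : ∀ d (f : Point (suc d) → ℕ) → Antipodal f → ev (alternation true f) (sphere M (suc d)) ≡ true
  alternation-sphere zero f f-antipodal = begin
    ev (alternation true f) (sphere M 1)
      ≡⟨ ev-sphere M 0 (alternation true f) ⟩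
    (W (ℤ.- + M) xor false) xor ((W (+ M) xor false) xor ev (alternation true f) (tower (ℤ.- + M) (M ℕ.+ M) (sphere M 0)))
      ≡⟨ cong₂ (λ x y → x xor (y xor ev (alternation true f) (tower (ℤ.- + M) (M ℕ.+ M) (sphere M 0))))
               (W≡w (ℤ.- + M)) (W≡w (+ M)) ⟩
    w (ℤ.- + M) xor (w (+ M) xor ev (alternation true f) (tower (ℤ.- + M) (M ℕ.+ M) (sphere M 0)))
      ≡⟨ cong (λ x → w (ℤ.- + M) xor (w (+ M) xor x)) (ev-false (empty (ℤ.- + M) (M ℕ.+ M))) ⟩
    w (ℤ.- + M) xor (w (+ M) xor false)
      ≡⟨ cong (w (ℤ.- + M) xor_) (xor-identityʳ _) ⟩
    w (ℤ.- + M) xor w (+ M)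
      ≡⟨ cong (λ x → alt true (minus (f (x ∷ [])) ∷ plus (f (ℤ.- + M ∷ [])) ∷ []) xor w (+ M)) (ℤₚ.neg-involutive (+ M)) ⟩
    alt true (minus (f (+ M ∷ [])) ∷ plus (f (ℤ.- + M ∷ [])) ∷ []) xor w (+ M)
      ≡⟨ alt-pair (f-antipodal zero (Step-refl _) refl (inj₂ refl) ∘ sym) ⟩
    true ∎
    where
    open ≡-Reasoning
    W w : ℤ → Bool
    W a = alternation true f ((a ∷ []) ∷ [])
    w a = alt true (minus (f (ℤ.- a ∷ [])) ∷ plus (f (a ∷ [])) ∷ [])
    W≡w : ∀ a → W a xor false ≡ w a
    W≡w a = ≡.trans (xor-identityʳ (W a)) (xor-identityʳ (w a))
    empty : ∀ a n → All (λ σ → alternation true f σ ≡ false) (tower a n (sphere M 0))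
    empty a n = Allₚ.++⁺ (All-column (λ _ → []) a n) []
  alternation-sphere (suc d) f f-antipodal = begin
    ev W (sphere M (suc (suc d)))
      ≡⟨ sphere-hemispheres M (suc d) W ⟩
    ev W H xor ev (W ∘ antipode) H
      ≡⟨ ev-xor W (W ∘ antipode) H ⟨
    ev (λ σ → W σ xor W (antipode σ)) H
      ≡⟨ ev-cong-All (All.zipWith coboundary (hemisphere-OnWall d , All.zip (hemisphere-Step (suc d) , hemisphere-length (suc d)))) ⟩
    ev (δ W) H
      ≡⟨ ∂-hemisphere M (suc d) W ⟩
    ev W (at 0ℤ (sphere M (suc d)))
      ≡⟨ ev-at W 0ℤ (sphere M (suc d)) ⟩
    ev (W ∘ map (0ℤ ∷_)) (sphere M (suc d))
      ≡⟨ ev-cong (λ σ → cong (ev (alt true)) (prism-map (lower f) (upper f) (0ℤ ∷_) σ)) (sphere M (suc d)) ⟩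
    ev (alternation true (f ∘ (0ℤ ∷_))) (sphere M (suc d))
      ≡⟨ alternation-sphere d (f ∘ (0ℤ ∷_)) (λ i s → f-antipodal (suc i) (inj₁ refl ∷ s)) ⟩
    true ∎
    where
    open ≡-Reasoning
    W = alternation true f
    H = hemisphere M (suc d)
    -- The antipodal copy of a simplex of `H` contributes its alternations starting with the other
    -- sign, so the two copies together contribute a coboundary. This moves the count to the
    -- boundary of `H`, the equator.
    coboundary : ∀ {σ} → OnWall σ × (AllPairs Step σ × length σ ≡ suc (suc d)) → W σ xor W (antipode σ) ≡ δ W σ
    coboundary {σ} (o , s , l) = ≡.trans
      (cong (W σ xor_) (alternation-antipode f σ (prism-Proper f f-antipodal o s)))
      (alternation-δ f σ (subst (2 ℕ.≤_) (sym l) (s≤s (s≤s z≤n))))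

-- Coning off faces

module _ (apex : List A → A′) (hi : A → A′) where

  -- Words run through a flag of faces, each of codimension one in the preceding one and recorded by
  -- its apex, and end with the `hi` vertices of the last face. The number is the count of vertices
  -- of `σ`, as recursion through `faces` is not structural.
  cone : ℕ → List A → Chain A′
  cone zero    σ = []
  cone (suc n) σ = map (apex σ ∷_) (map hi σ ∷ concatMap (cone n) (faces σ))

  -- Complete flags only: the barycentric subdivision, with apices in place of barycentres.
  apices : ℕ → List A → Chain A′
  apices zero    σ = [] ∷ []
  apices (suc n) σ = map (apex σ ∷_) (concatMap (apices n) (faces σ))

  ev-cone : ∀ n (c : List A′ → Bool) σ → ev c (cone (suc n) σ) ≡
            c (apex σ ∷ map hi σ) xor ev (λ ρ → ev (c ∘ (apex σ ∷_)) (cone n ρ)) (faces σ)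
  ev-cone n c σ = ≡.trans (ev-map c (apex σ ∷_) (map hi σ ∷ concatMap (cone n) (faces σ)))
    (cong (c (apex σ ∷ map hi σ) xor_) (ev-concatMap (c ∘ (apex σ ∷_)) (cone n) (faces σ)))

  -- The analogue of `δ-prism`: the cones form a homotopy from the barycentric subdivision to the
  -- image under `hi`.
  δ-cone : ∀ n (c : List A′ → Bool) σ → length σ ≡ n →
           ev (δ c) (cone n σ) ≡
           c (map hi σ) xor (δ (λ ρ → ev c (cone (ℕ.pred n) ρ)) σ xor ev c (apices n σ))
  δ-cone zero    c []      refl = sym (≡.trans (cong (c [] xor_) (xor-identityʳ (c []))) (xor-same (c [])))
  δ-cone (suc n) c (x ∷ τ) len  = begin
    ev (δ c) (map (p ∷_) (map hi σ ∷ K))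
      ≡⟨ ev-map (δ c) (p ∷_) (map hi σ ∷ K) ⟩
    ev (λ w → δ c (p ∷ w)) (map hi σ ∷ K)
      ≡⟨ ev-cong (δ-∷ c p) (map hi σ ∷ K) ⟩
    ev (λ w → c w xor δ c′ w) (map hi σ ∷ K)
      ≡⟨ ev-xor c (δ c′) (map hi σ ∷ K) ⟩
    (c (map hi σ) xor ev c K) xor (δ c′ (map hi σ) xor ev (δ c′) K)
      ≡⟨ cong₂ (λ a b → (c (map hi σ) xor ev c K) xor (a xor b)) (δ-map hi c′ σ) coned ⟩
    (c (map hi σ) xor ev c K) xor (h xor (h xor (false xor r)))
      ≡⟨ cong (λ a → (c (map hi σ) xor ev c K) xor a) (≡.trans (sym (xor-assoc h h r)) (cong (_xor r) (xor-same h))) ⟩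
    (c (map hi σ) xor ev c K) xor r
      ≡⟨ xor-assoc (c (map hi σ)) (ev c K) r ⟩
    c (map hi σ) xor (ev c K xor r)
      ≡⟨ cong (c (map hi σ) xor_) (cong₂ _xor_ (ev-concatMap c (cone n) (faces σ))
           (≡.trans (sym (ev-concatMap c′ (apices n) (faces σ)))
                    (sym (ev-map c (p ∷_) (concatMap (apices n) (faces σ)))))) ⟩
    c (map hi σ) xor (δ (λ ρ → ev c (cone n ρ)) σ xor ev c (apices (suc n) σ)) ∎
    where
    open ≡-Reasoning
    σ = x ∷ τ
    p = apex σ
    c′ = c ∘ (p ∷_)
    K = concatMap (cone n) (faces σ)
    h = δ (c′ ∘ map hi) σ
    r = δ (λ ρ → ev c′ (apices n ρ)) σ
    length-τ : length τ ≡ n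
    length-τ = ℕₚ.suc-injective len
    q : List A → Bool
    q ρ = ev c′ (cone (ℕ.pred n) ρ)
    coned : ev (δ c′) K ≡ h xor (false xor r)
    coned = begin
      ev (δ c′) K
        ≡⟨ ev-concatMap (δ c′) (cone n) (faces σ) ⟩
      ev (λ ρ → ev (δ c′) (cone n ρ)) (faces σ)
        ≡⟨ ev-cong-All (All.map (λ {ρ} e → δ-cone n c′ ρ (≡.trans e length-τ)) (faces-length x τ)) ⟩
      ev (λ ρ → c′ (map hi ρ) xor (δ q ρ xor ev c′ (apices n ρ))) (faces σ)
        ≡⟨ ev-xor (c′ ∘ map hi) (λ ρ → δ q ρ xor ev c′ (apices n ρ)) (faces σ) ⟩
      h xor ev (λ ρ → δ q ρ xor ev c′ (apices n ρ)) (faces σ)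
        ≡⟨ cong (h xor_) (ev-xor (δ q) (λ ρ → ev c′ (apices n ρ)) (faces σ)) ⟩
      h xor (ev (δ q) (faces σ) xor r)
        -- A face of codimension two is reached through two facets, so the cones over it cancel.
        ≡⟨ cong (λ a → h xor (a xor r)) (δδ q σ) ⟩
      h xor (false xor r) ∎

  cone-All : {P : A′ → Set} → (∀ σ → P (apex σ)) → ∀ n {σ} → All (P ∘ hi) σ → All (All P) (cone n σ)
  cone-All p zero    q = []
  cone-All p (suc n) {σ} q = Allₚ.map⁺ (All.map (p σ ∷_)
    (Allₚ.map⁺ q ∷ All-concatMap (cone-All p n) (faces-All q)))

  -- Each `hi` vertex following an apex belongs to a face of the simplex of that apex, so it is
  -- enough to relate an apex to the vertices of its own simplex.
  cone-AllPairs : {R : A′ → A′ → Set} {P : List A → Set} →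
                  (∀ {σ} → P σ → All P (faces σ)) →
                  (∀ {σ} → P σ → All (R (apex σ) ∘ hi) σ) →
                  (∀ σ ρ → R (apex σ) (apex ρ)) → (∀ v u → R (hi v) (hi u)) →
                  ∀ n {σ} → P σ → All (AllPairs R) (cone n σ)
  cone-AllPairs her r a b zero    p = []
  cone-AllPairs her r a b (suc n) {σ} p = Allₚ.map⁺ (All.zipWith (λ (x , y) → x ∷ y)
    ( Allₚ.map⁺ (r p) ∷ All-concatMap (cone-All (a σ) n) (faces-All (r p))
    , AllPairsₚ.map⁺ (AllPairs-universal σ) ∷ All-concatMap (cone-AllPairs her r a b n) (her p)))
    where
    AllPairs-universal : ∀ σ → AllPairs (λ v u → _) σ
    AllPairs-universal []      = []
    AllPairs-universal (x ∷ σ) = All.universal (b x) σ ∷ AllPairs-universal σ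

  cone-length : ∀ n {σ} → length σ ≡ n → All (λ w → length w ≡ suc n) (cone n σ)
  cone-length zero    e = []
  cone-length (suc n) {x ∷ σ} e = Allₚ.map⁺ (All.map (cong suc)
    (≡.trans (Listₚ.length-map hi (x ∷ σ)) e ∷
     All-concatMap (λ e′ → cone-length n (≡.trans e′ (ℕₚ.suc-injective e))) (faces-length x σ)))

  apices-All : {P : A′ → Set} → (∀ σ → P (apex σ)) → ∀ n σ → All (All P) (apices n σ)
  apices-All p zero    σ = [] ∷ []
  apices-All p (suc n) σ = Allₚ.map⁺ (All.map (p σ ∷_)
    (All-concatMap-universal (apices-All p n) (faces σ)))

  apices-nonempty : ∀ n σ → All (λ w → 1 ℕ.≤ length w) (apices (suc n) σ)
  apices-nonempty n σ = Allₚ.map⁺ (All.universal (λ _ → s≤s z≤n) _)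

-- Where the apices are the first vertices, only the terms of the prism have no repeated vertex.
cone-prism : (centre : List A → A) (lo hi : A → A′) {P : List A → Set} →
             (∀ {σ} → P σ → All P (faces σ)) → (∀ {v σ} → P (v ∷ σ) → centre (v ∷ σ) ≡ v) →
             ∀ n (c : List A′ → Bool) → (∀ π x w → c (π ++ x ∷ x ∷ w) ≡ false) →
             ∀ {σ} → P σ → length σ ≡ n → ev c (cone (lo ∘ centre) hi n σ) ≡ ev c (prism lo hi σ)
cone-prism centre lo hi her first zero    c norm {[]}    p e = refl
cone-prism centre lo hi {P} her first (suc n) c norm {v ∷ σ} p e
  with her p | first p
... | q ∷ qs | eq = begin
  ev c (cone a hi (suc n) (v ∷ σ))
    ≡⟨ ev-cone a hi n c (v ∷ σ) ⟩
  c (a (v ∷ σ) ∷ map hi (v ∷ σ)) xor ev (λ ρ → ev (c ∘ (a (v ∷ σ) ∷_)) (cone a hi n ρ)) (faces (v ∷ σ))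
    ≡⟨ cong (λ u → c (lo u ∷ map hi (v ∷ σ)) xor ev (λ ρ → ev (c ∘ (lo u ∷_)) (cone a hi n ρ)) (faces (v ∷ σ))) eq ⟩
  c (lo v ∷ map hi (v ∷ σ)) xor (ev c′ (cone a hi n σ) xor ev (λ ρ → ev c′ (cone a hi n ρ)) (map (v ∷_) (faces σ)))
    ≡⟨ cong (c (lo v ∷ map hi (v ∷ σ)) xor_) (cong₂ _xor_
         (cone-prism centre lo hi her first n c′ (norm ∘ (lo v ∷_)) q (ℕₚ.suc-injective e))
         (≡.trans (ev-map (λ ρ → ev c′ (cone a hi n ρ)) (v ∷_) (faces σ))
                  (ev-false (All.map (repeated n) (Allₚ.map⁻ qs))))) ⟩
  c (lo v ∷ map hi (v ∷ σ)) xor (ev c′ (prism lo hi σ) xor false)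
    ≡⟨ cong (c (lo v ∷ map hi (v ∷ σ)) xor_) (xor-identityʳ _) ⟩
  c (lo v ∷ map hi (v ∷ σ)) xor ev c′ (prism lo hi σ)
    ≡⟨ ev-prism-∷ lo hi c v σ ⟨
  ev c (prism lo hi (v ∷ σ)) ∎
  where
  open ≡-Reasoning
  a = lo ∘ centre
  c′ = c ∘ (lo v ∷_)
  repeated : ∀ n {ρ} → P (v ∷ ρ) → ev c′ (cone a hi n (v ∷ ρ)) ≡ false
  repeated zero    p = refl
  repeated (suc n) {ρ} p = ≡.trans (ev-map c′ (a (v ∷ ρ) ∷_) (map hi (v ∷ ρ) ∷ concatMap (cone a hi n) (faces (v ∷ ρ))))
    (ev-false (All.universal (λ w → ≡.trans (cong (λ u → c (lo v ∷ lo u ∷ w)) (first p)) (norm [] (lo v) w))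
                         (map hi (v ∷ ρ) ∷ concatMap (cone a hi n) (faces (v ∷ ρ)))))

-- The dome

range : ℤ → ℕ → List ℤ
range a zero    = []
range a (suc n) = a ∷ range (1ℤ ℤ.+ a) n

grid : Point d → ℕ → List (Point d)
grid []       n = [] ∷ []
grid (a ∷ as) n = concatMap (λ b → map (b ∷_) (grid as n)) (range a n)

tower-range : (c : List (Point (suc d)) → Bool) (a : ℤ) (n : ℕ) (z : Chain (Point d)) →
              ev c (tower a n z) ≡ ev (λ b → ev c (tower b 1 z)) (range a n)
tower-range c a zero    z = ≡.trans (ev-tower c a 0 z) (ev-false {z = z} (All.universal (λ _ → refl) z))
tower-range c a (suc n) z = begin
  ev c (tower a (suc n) z)
    ≡⟨ ev-tower c a (suc n) z ⟩
  ev (λ σ → ev c (column a (suc n) σ)) z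
    ≡⟨ ev-cong (λ σ → column-+ c a 1 n σ) z ⟩
  ev (λ σ → ev c (column a 1 σ) xor ev c (column (a ℤ.+ 1ℤ) n σ)) z
    ≡⟨ ev-xor (λ σ → ev c (column a 1 σ)) (λ σ → ev c (column (a ℤ.+ 1ℤ) n σ)) z ⟩
  ev (λ σ → ev c (column a 1 σ)) z xor ev (λ σ → ev c (column (a ℤ.+ 1ℤ) n σ)) z
    ≡⟨ cong₂ _xor_ (ev-tower c a 1 z) (ev-tower c (a ℤ.+ 1ℤ) n z) ⟨
  ev c (tower a 1 z) xor ev c (tower (a ℤ.+ 1ℤ) n z)
    ≡⟨ cong (λ b → ev c (tower a 1 z) xor ev c (tower b n z)) (ℤₚ.+-comm a 1ℤ) ⟩
  ev c (tower a 1 z) xor ev c (tower (1ℤ ℤ.+ a) n z)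
    ≡⟨ cong (ev c (tower a 1 z) xor_) (tower-range c (1ℤ ℤ.+ a) n z) ⟩
  ev (λ b → ev c (tower b 1 z)) (range a (suc n)) ∎
  where open ≡-Reasoning

box-grid : (as : Point d) (n : ℕ) (c : List (Point d) → Bool) →
           ev c (box as n) ≡ ev (λ u → ev c (box u 1)) (grid as n)
box-grid []       n c = sym (xor-identityʳ _)
box-grid (a ∷ as) n c = begin
  ev c (tower a n (box as n))
    ≡⟨ tower-range c a n (box as n) ⟩
  ev (λ b → ev c (tower b 1 (box as n))) (range a n)
    ≡⟨ ev-cong row (range a n) ⟩
  ev (λ b → ev (λ u → ev c (box u 1)) (map (b ∷_) (grid as n))) (range a n)
    ≡⟨ ev-concatMap (λ u → ev c (box u 1)) (λ b → map (b ∷_) (grid as n)) (range a n) ⟨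
  ev (λ u → ev c (box u 1)) (grid (a ∷ as) n) ∎
  where
  open ≡-Reasoning
  row : ∀ b → ev c (tower b 1 (box as n)) ≡ ev (λ u → ev c (box u 1)) (map (b ∷_) (grid as n))
  row b = begin
    ev c (tower b 1 (box as n))
      ≡⟨ ev-tower c b 1 (box as n) ⟩
    ev (λ σ → ev c (column b 1 σ)) (box as n)
      ≡⟨ box-grid as n (λ σ → ev c (column b 1 σ)) ⟩
    ev (λ u → ev (λ σ → ev c (column b 1 σ)) (box u 1)) (grid as n)
      ≡⟨ ev-cong (λ u → sym (ev-tower c b 1 (box u 1))) (grid as n) ⟩
    ev (λ u → ev c (box (b ∷ u) 1)) (grid as n)
      ≡⟨ ev-map (λ u → ev c (box u 1)) (b ∷_) (grid as n) ⟨
    ev (λ u → ev c (box u 1)) (map (b ∷_) (grid as n)) ∎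

-- Walls between neighbouring unit cubes cancel. This comes for free from `∂-box`, used once for the
-- large cube and once for every small one.
shell-grid : (as : Point d) (n : ℕ) (c : List (Point d) → Bool) →
             ev c (shell as n) ≡ ev (λ u → ev c (shell u 1)) (grid as n)
shell-grid as n c = ≡.trans (sym (∂-box as n c)) (≡.trans (box-grid as n (δ c))
  (ev-cong (λ u → ∂-box u 1 c) (grid as n)))

all-up : Point d → Point d
all-up = Vec.map (λ a → 1ℤ ℤ.+ a)

module _ (M : ℕ) where

  -- A full simplex of the cube at `u` contains both ends of the long diagonal, whose difference is
  -- not in the middle layer. Coning the boundary from one level higher avoids this: the summit
  -- needs only the top layer, where the large weight of `all-up u` is welcome.
  summit : Point d → Point (suc d)
  summit u = 1ℤ ℤ.+ + M ∷ all-up u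

  pyramid : Point d → Chain (Point (suc d))
  pyramid u = map (summit u ∷_) (at (+ M) (shell u 1))

  lid dome : ∀ d → Chain (Point (suc d))
  lid d  = concatMap pyramid (grid (corner M d) (M ℕ.+ M))
  dome d = tower 0ℤ M (sphere M d) ++ lid d

  ∂-pyramid : ∀ {d} (u : Point d) c → ev (δ c) (pyramid u) ≡ ev c (at (+ M) (shell u 1))
  ∂-pyramid u c = begin
    ev (δ c) (pyramid u)
      ≡⟨ ev-map (δ c) (summit u ∷_) Z ⟩
    ev (λ σ → δ c (summit u ∷ σ)) Z
      ≡⟨ ev-cong (δ-∷ c (summit u)) Z ⟩
    ev (λ σ → c σ xor δ c′ σ) Z
      ≡⟨ ev-xor c (δ c′) Z ⟩
    ev c Z xor ev (δ c′) Z
      ≡⟨ cong (ev c Z xor_) (ev-at (δ c′) (+ M) (shell u 1)) ⟩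
    ev c Z xor ev (δ c′ ∘ map (+ M ∷_)) (shell u 1)
      ≡⟨ cong (ev c Z xor_) (≡.trans (ev-cong (δ-map (+ M ∷_) c′) (shell u 1)) (∂-shell u 1 (c′ ∘ map (+ M ∷_)))) ⟩
    ev c Z xor false
      ≡⟨ xor-identityʳ _ ⟩
    ev c Z ∎
    where
    open ≡-Reasoning
    Z = at (+ M) (shell u 1)
    c′ = c ∘ (summit u ∷_)

  ∂-lid : ∀ d c → ev (δ c) (lid d) ≡ ev c (at (+ M) (sphere M d))
  ∂-lid d c = begin
    ev (δ c) (lid d)
      ≡⟨ ev-concatMap (δ c) pyramid us ⟩
    ev (λ u → ev (δ c) (pyramid u)) us
      ≡⟨ ev-cong (λ u → ≡.trans (∂-pyramid u c) (ev-at c (+ M) (shell u 1))) us ⟩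
    ev (λ u → ev (c ∘ map (+ M ∷_)) (shell u 1)) us
      ≡⟨ shell-grid (corner M d) (M ℕ.+ M) (c ∘ map (+ M ∷_)) ⟨
    ev (c ∘ map (+ M ∷_)) (sphere M d)
      ≡⟨ ev-at c (+ M) (sphere M d) ⟨
    ev c (at (+ M) (sphere M d)) ∎
    where
    open ≡-Reasoning
    us = grid (corner M d) (M ℕ.+ M)

  ∂-dome : ∀ d c → ev (δ c) (dome d) ≡ ev c (at 0ℤ (sphere M d))
  ∂-dome d c = begin
    ev (δ c) (dome d)
      ≡⟨ ev-++ (δ c) (tower 0ℤ M (sphere M d)) (lid d) ⟩
    ev (δ c) (tower 0ℤ M (sphere M d)) xor ev (δ c) (lid d)
      ≡⟨ cong₂ _xor_ (δ-tower-sphere M d c) (∂-lid d c) ⟩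
    (x xor y) xor y
      ≡⟨ ≡.trans (xor-assoc x y y) (≡.trans (cong (x xor_) (xor-same y)) (xor-identityʳ x)) ⟩
    x ∎
    where
    open ≡-Reasoning
    x = ev c (at 0ℤ (sphere M d))
    y = ev c (at (+ M) (sphere M d))

  dome-length : ∀ d → All (λ σ → length σ ≡ suc d) (dome d)
  dome-length d = Allₚ.++⁺ (All-concatMap (λ p → column-length p 0ℤ M) (shell-length (corner M d) (M ℕ.+ M)))
    (All-concatMap-universal (λ u → Allₚ.map⁺ (All.map (cong suc) (at-length (shell-length u 1) (+ M))))
                             (grid (corner M d) (M ℕ.+ M)))

-- Covering the dome by translates of the sandwich

-- For `Step v u` this is the number of coordinates raised between `v` and `u`, the quantity that
-- the layers of the sandwich bound.
weight : Point d → Point d → ℤ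
weight v u = vsum (zipWith ℤ._-_ u v)

one-minus : ∀ a → 1ℤ ℤ.+ a ℤ.- a ≡ 1ℤ
one-minus = solve-∀

Step-binary : {v u : Point d} → Step v u → Binary (zipWith ℤ._-_ u v)
Step-binary []                    = VAll.[]
Step-binary (_∷_ {x = a} (inj₁ refl) s) = inj₁ (ℤₚ.+-inverseʳ a) VAll.∷ Step-binary s
Step-binary (_∷_ {x = a} (inj₂ refl) s) = inj₂ (one-minus a) VAll.∷ Step-binary s

weight-+ : (v u w : Point d) → weight v u ℤ.+ weight u w ≡ weight v w
weight-+ []      []      []      = refl
weight-+ (a ∷ v) (b ∷ u) (c ∷ w) = ≡.trans (e a b c (weight v u) (weight u w)) (cong (λ x → (c ℤ.- a) ℤ.+ x) (weight-+ v u w))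
  where
  e : ∀ a b c x y → ((b ℤ.- a) ℤ.+ x) ℤ.+ ((c ℤ.- b) ℤ.+ y) ≡ (c ℤ.- a) ℤ.+ (x ℤ.+ y)
  e = solve-∀

weight-stay : ∀ (a : ℤ) (v u : Point d) → weight (a ∷ v) (a ∷ u) ≡ weight v u
weight-stay a v u = ≡.trans (cong (λ x → x ℤ.+ weight v u) (ℤₚ.+-inverseʳ a)) (ℤₚ.+-identityˡ _)

weight-move : ∀ (a : ℤ) (v u : Point d) → weight (a ∷ v) (1ℤ ℤ.+ a ∷ u) ≡ 1ℤ ℤ.+ weight v u
weight-move a v u = cong (λ x → x ℤ.+ weight v u) (one-minus a)

weight-≥0 : {v u : Point d} → Step v u → 0ℤ ℤ.≤ weight v u
weight-≥0 []                                      = ℤₚ.≤-refl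
weight-≥0 {v = a ∷ v} {_ ∷ u} (inj₁ refl ∷ s) = subst (λ x → 0ℤ ℤ.≤ x) (sym (weight-stay a v u)) (weight-≥0 s)
weight-≥0 {v = a ∷ v} {_ ∷ u} (inj₂ refl ∷ s) =
  subst (λ x → 0ℤ ℤ.≤ x) (sym (weight-move a v u)) (ℤₚ.i≤j⇒i≤k+j 1ℤ (weight-≥0 s))

weight-≤ : {v u : Point d} → Step v u → weight v u ℤ.≤ + d
weight-≤ []                                      = ℤₚ.≤-refl
weight-≤ {v = a ∷ v} {_ ∷ u} (inj₁ refl ∷ s) =
  subst (λ x → x ℤ.≤ _) (sym (weight-stay a v u)) (ℤₚ.i≤j⇒i≤k+j 1ℤ (weight-≤ s))
weight-≤ {v = a ∷ v} {_ ∷ u} (inj₂ refl ∷ s) =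
  subst (λ x → x ℤ.≤ _) (sym (weight-move a v u)) (ℤₚ.+-monoʳ-≤ 1ℤ (weight-≤ s))

≤⇒<suc : ∀ {a b} → a ℤ.≤ b → a ℤ.< 1ℤ ℤ.+ b
≤⇒<suc p = ℤₚ.suc[i]≤j⇒i<j (ℤₚ.+-monoʳ-≤ 1ℤ p)

weight-monoʳ-≤ : ∀ {u v w : Point d} → Step u w → weight v u ℤ.≤ weight v w
weight-monoʳ-≤ {u = u} {v} {w} s = begin
  weight v u                  ≡⟨ ℤₚ.+-identityʳ (weight v u) ⟨
  weight v u ℤ.+ 0ℤ           ≤⟨ ℤₚ.+-monoʳ-≤ (weight v u) (weight-≥0 s) ⟩
  weight v u ℤ.+ weight u w   ≡⟨ weight-+ v u w ⟩
  weight v w                  ∎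
  where open ℤₚ.≤-Reasoning

-- On a wall one coordinate is constant; moving the centre in that direction changes all weights by one.
down up : Fin d → Point d → Point d
down i v = updateAt v i (λ a → -1ℤ ℤ.+ a)
up   i v = updateAt v i (λ a → 1ℤ ℤ.+ a)

down-Step : ∀ {v u : Point d} i → Step v u → lookup u i ≡ lookup v i →
            Step (down i v) u × weight (down i v) u ≡ 1ℤ ℤ.+ weight v u
down-Step {v = a ∷ v} {_ ∷ u} zero (_ ∷ s) refl = inj₂ (e a) ∷ s , e′ a (weight v u)
  where
  e : ∀ a → a ≡ 1ℤ ℤ.+ (-1ℤ ℤ.+ a)
  e = solve-∀
  e′ : ∀ a x → (a ℤ.- (-1ℤ ℤ.+ a)) ℤ.+ x ≡ 1ℤ ℤ.+ ((a ℤ.- a) ℤ.+ x)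
  e′ = solve-∀
down-Step {v = a ∷ v} {b ∷ u} (suc i) (p ∷ s) q with down-Step i s q
... | s′ , e = p ∷ s′ , ≡.trans (cong (λ x → (b ℤ.- a) ℤ.+ x) e) (e′ (b ℤ.- a) (weight v u))
  where
  e′ : ∀ a x → a ℤ.+ (1ℤ ℤ.+ x) ≡ 1ℤ ℤ.+ (a ℤ.+ x)
  e′ = solve-∀

up-Step : ∀ {v u : Point d} i → Step v u → lookup u i ≡ 1ℤ ℤ.+ lookup v i →
          Step (up i v) u × 1ℤ ℤ.+ weight (up i v) u ≡ weight v u
up-Step {v = a ∷ v} {_ ∷ u} zero (_ ∷ s) refl = inj₁ refl ∷ s , e′ a (weight v u)
  where
  e′ : ∀ a x → 1ℤ ℤ.+ (((1ℤ ℤ.+ a) ℤ.- (1ℤ ℤ.+ a)) ℤ.+ x) ≡ ((1ℤ ℤ.+ a) ℤ.- a) ℤ.+ x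
  e′ = solve-∀
up-Step {v = a ∷ v} {b ∷ u} (suc i) (p ∷ s) q with up-Step i s q
... | s′ , e = p ∷ s′ , ≡.trans (e′ (b ℤ.- a) (weight (up i v) u)) (cong (λ x → (b ℤ.- a) ℤ.+ x) e)
  where
  e′ : ∀ a x → 1ℤ ℤ.+ (a ℤ.+ x) ≡ a ℤ.+ (1ℤ ℤ.+ x)
  e′ = solve-∀

weight-< : ∀ {v u : Point d} i → Step v u → lookup u i ≡ lookup v i → weight v u ℤ.< + d
weight-< i s q with down-Step i s q
... | s′ , e = ℤₚ.suc[i]≤j⇒i<j (subst (λ x → x ℤ.≤ _) e (weight-≤ s′))

all-up-Step : (v : Point d) → Step v (all-up v)
all-up-Step []      = []
all-up-Step (a ∷ v) = inj₂ refl ∷ all-up-Step v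

weight-all-up : (v : Point d) → weight v (all-up v) ≡ + d
weight-all-up []      = refl
weight-all-up (a ∷ v) = ≡.trans (weight-move a v (all-up v)) (cong (λ x → 1ℤ ℤ.+ x) (weight-all-up v))

-- Singles out the vertex `m` over which a simplex of the prism climbs, so that a single comparison
-- of the weight of `m` with `s` can decide where its centre goes.
prism-split : {R : A → A → Set} {lo hi : A → A′} → (∀ v → R v v) → {P : A → Set} →
              {σ : List A} → All P σ → AllPairs R σ →
              All (λ w → Σ A λ m → P m × All (λ x → (Σ A λ u → P u × R u m × x ≡ lo u) ⊎
                                                    (Σ A λ u → P u × R m u × x ≡ hi u)) w) (prism lo hi σ)
prism-split rfl []       []       = []
prism-split {R = R} rfl (_∷_ {v} p ps) (r ∷ rs) =
  (v , p , inj₁ (v , p , rfl v , refl) ∷ inj₂ (v , p , rfl v , refl) ∷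
           Allₚ.map⁺ (All.zipWith (λ (q , s) → inj₂ (_ , q , s , refl)) (ps , r))) ∷
  Allₚ.map⁺ (All.map
    (λ { (m , (q , s) , a) → m , q , inj₁ (v , p , s , refl) ∷
         All.map (λ { (inj₁ (u , (q′ , _) , t)) → inj₁ (u , q′ , t)
                    ; (inj₂ (u , (q′ , _) , t)) → inj₂ (u , q′ , t) }) a })
    (prism-split {R = R} rfl (All.zip (ps , r)) rs))

search : {P : A → Set} → (∀ x → Dec (P x)) → A → List A → A
search P? x []       = x
search P? x (y ∷ ys) with P? y
... | yes _ = y
... | no  _ = search P? x ys

search-sound : {P : A → Set} (P? : ∀ x → Dec (P x)) (x : A) {ys : List A} → Any P ys → P (search P? x ys)
search-sound P? x {y ∷ ys} a with P? y | a
... | yes p | _       = p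
... | no ¬p | here p  = ⊥-elim (¬p p)
... | no ¬p | there b = search-sound P? x b

search-head : {P : A → Set} (P? : ∀ x → Dec (P x)) (x : A) {y : A} (ys : List A) → P y → search P? x (y ∷ ys) ≡ y
search-head P? x {y} ys p with P? y
... | yes _ = refl
... | no ¬p = ⊥-elim (¬p p)

InSandwich? : (k : ℕ) (s : ℤ) (x : G k) → Dec (InSandwich k s x)
InSandwich? k s (t , v) = VAll.all? (λ a → (a ℤₚ.≟ 0ℤ) ⊎-dec (a ℤₚ.≟ 1ℤ)) v ×-dec
  (((t ℤₚ.≟ -1ℤ) ×-dec (vsum v ℤₚ.<? s)) ⊎-dec
   (((t ℤₚ.≟ 0ℤ) ×-dec (vsum v ℤₚ.<? + k)) ⊎-dec ((t ℤₚ.≟ 1ℤ) ×-dec (s ℤₚ.<? vsum v))))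

binaries : ∀ k → List (Vec ℤ k)
binaries zero    = [] ∷ []
binaries (suc k) = map (0ℤ ∷_) (binaries k) ++ map (1ℤ ∷_) (binaries k)

∈-binaries : {v : Vec ℤ k} → Binary v → v ∈ binaries k
∈-binaries VAll.[]                    = here refl
∈-binaries (inj₁ refl VAll.∷ b) = ∈ₚ.∈-++⁺ˡ (∈ₚ.∈-map⁺ (0ℤ ∷_) (∈-binaries b))
∈-binaries (inj₂ refl VAll.∷ b) = ∈ₚ.∈-++⁺ʳ (map (0ℤ ∷_) (binaries _)) (∈ₚ.∈-map⁺ (1ℤ ∷_) (∈-binaries b))

candidates : ∀ k → List (Point (suc k))
candidates k = concatMap (λ t → map (t ∷_) (binaries k)) (-1ℤ ∷ 0ℤ ∷ 1ℤ ∷ [])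

∈-candidates : ∀ {s t} {v : Vec ℤ k} → InSandwich k s (t , v) → t ∷ v ∈ candidates k
∈-candidates {k} {v = v} (b , cases) = ∈ₚ.∈-concatMap⁺ (λ t → map (t ∷_) (binaries k)) (layer cases)
  where
  layer : ∀ {t} {X Y Z : Set} → (t ≡ -1ℤ × X) ⊎ (t ≡ 0ℤ × Y) ⊎ (t ≡ 1ℤ × Z) →
          Any (λ t′ → t ∷ v ∈ map (t′ ∷_) (binaries k)) (-1ℤ ∷ 0ℤ ∷ 1ℤ ∷ [])
  layer (inj₁ (refl , _))        = here (∈ₚ.∈-map⁺ (-1ℤ ∷_) (∈-binaries b))
  layer (inj₂ (inj₁ (refl , _))) = there (here (∈ₚ.∈-map⁺ (0ℤ ∷_) (∈-binaries b)))
  layer (inj₂ (inj₂ (refl , _))) = there (there (here (∈ₚ.∈-map⁺ (1ℤ ∷_) (∈-binaries b))))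

module Sandwich (k : ℕ) (s : ℤ) (s≤k-2 : s ℤ.≤ + k ℤ.- + 2) where

  InΞ : Point (suc k) → Set
  InΞ (t ∷ v) = InSandwich k s (t , v)

  Near : Point (suc k) → Point (suc k) → Set
  Near x y = InΞ (zipWith ℤ._-_ x y)

  Near? : ∀ x y → Dec (Near x y)
  Near? (t ∷ v) (t′ ∷ v′) = InSandwich? k s (t ℤ.- t′ , zipWith ℤ._-_ v v′)

  Covered : List (Point (suc k)) → Set
  Covered σ = Σ (Point (suc k)) λ y → All (λ x → Near x y) σ

  level : ∀ t {v u : Point k} → Step v u → weight v u ℤ.< + k → Near (t ∷ u) (t ∷ v)
  level t st p = Step-binary st , inj₂ (inj₁ (ℤₚ.+-inverseʳ t , p))

  above : ∀ t {v u : Point k} → Step v u → s ℤ.< weight v u → Near (1ℤ ℤ.+ t ∷ u) (t ∷ v)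
  above t st p = Step-binary st , inj₂ (inj₂ (one-minus t , p))

  below : ∀ t {v u : Point k} → Step v u → weight v u ℤ.< s → Near (t ∷ u) (1ℤ ℤ.+ t ∷ v)
  below t st p = Step-binary st , inj₁ (e t , p)
    where
    e : ∀ t → t ℤ.- (1ℤ ℤ.+ t) ≡ -1ℤ
    e = solve-∀

  1+s<k : 1ℤ ℤ.+ s ℤ.< + k
  1+s<k = ℤₚ.suc[i]≤j⇒i<j (subst (λ x → 1ℤ ℤ.+ (1ℤ ℤ.+ s) ℤ.≤ x) (e (+ k)) (ℤₚ.+-monoʳ-≤ 1ℤ (ℤₚ.+-monoʳ-≤ 1ℤ s≤k-2)))
    where
    e : ∀ k → 1ℤ ℤ.+ (1ℤ ℤ.+ (k ℤ.- + 2)) ≡ k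
    e = solve-∀

  s<k : s ℤ.< + k
  s<k = ℤₚ.<-trans (≤⇒<suc ℤₚ.≤-refl) 1+s<k

  difference : ∀ {n} (x y : Point n) → zipWith ℤ._-_ x (zipWith ℤ._-_ x y) ≡ y
  difference []      []      = refl
  difference (a ∷ x) (b ∷ y) = cong₂ _∷_ (e a b) (difference x y)
    where
    e : ∀ a b → a ℤ.- (a ℤ.- b) ≡ b
    e = solve-∀

  covers? : ∀ σ y → Dec (All (λ x → Near x y) σ)
  covers? σ y = All.all? (λ x → Near? x y) σ

  -- The head is tried first, which makes cones agree with prisms over the equator. Otherwise x - c
  -- is tried for the finitely many candidates c; the default is reached only when nothing covers
  -- the simplex. The centre depends on the face alone, so that `value` is a cochain.
  centre : List (Point (suc k)) → Point (suc k)
  centre []      = replicate (suc k) 0ℤ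
  centre (x ∷ σ) = search (covers? (x ∷ σ)) x (x ∷ map (zipWith ℤ._-_ x) (candidates k))

  centre-covers : ∀ {σ} → Covered σ → All (λ x → Near x (centre σ)) σ
  centre-covers {[]}    _             = []
  centre-covers {x ∷ σ} (y , n ∷ ns) = search-sound (covers? (x ∷ σ)) x
    (there (Any.map (λ { refl → n ∷ ns })
      (subst (_∈ map (zipWith ℤ._-_ x) (candidates k)) (difference x y) (∈ₚ.∈-map⁺ (zipWith ℤ._-_ x) (candidate x y n)))))
    where
    candidate : ∀ x y → Near x y → zipWith ℤ._-_ x y ∈ candidates k
    candidate (t ∷ v) (t′ ∷ v′) = ∈-candidates

  centre-head : ∀ {v σ} → All (λ x → Near x v) (v ∷ σ) → centre (v ∷ σ) ≡ v
  centre-head {v} {σ} = search-head (covers? (v ∷ σ)) v (map (zipWith ℤ._-_ v) (candidates k))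

  wall-Covered : ∀ {σ i a} → AllPairs Step σ → All (λ v → lookup v i ≡ a) σ → ∀ t →
                 All Covered (prism (t ∷_) (1ℤ ℤ.+ t ∷_) σ)
  wall-Covered {[]}        _          _        t = []
  wall-Covered {v ∷ σ} {i} (r ∷ rs) (p ∷ ps) t =
    All.map cover (prism-split {R = Step} Step-refl
      {P = λ u → Step v u × lookup u i ≡ lookup v i}
      ((Step-refl v , refl) ∷ All.zipWith (λ (st , q) → st , ≡.trans q (sym p)) (r , ps)) (r ∷ rs))
    where
    On : Point k → Set
    On u = Step v u × lookup u i ≡ lookup v i
    cover : ∀ {w} → (Σ (Point k) λ m → On m × All (λ x → (Σ (Point k) λ u → On u × Step u m × x ≡ t ∷ u) ⊎
                                                       (Σ (Point k) λ u → On u × Step m u × x ≡ 1ℤ ℤ.+ t ∷ u)) w) →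
            Covered w
    -- m is the vertex at which the simplex climbs: weights at level t are at most that of m,
    -- and weights at level t + 1 at least that of m.
    cover (m , _ , a) with ℤₚ.<-cmp (weight v m) s
    ... | tri< lt _ _ = 1ℤ ℤ.+ t ∷ v , All.map
      (λ { (inj₁ (u , (st , q) , n , refl)) → below t st (ℤₚ.≤-<-trans (weight-monoʳ-≤ n) lt)
         ; (inj₂ (u , (st , q) , n , refl)) → level (1ℤ ℤ.+ t) st (weight-< i st q) }) a
    ... | tri> _ _ gt = t ∷ v , All.map
      (λ { (inj₁ (u , (st , q) , n , refl)) → level t st (weight-< i st q)
         ; (inj₂ (u , (st , q) , n , refl)) → above t st (ℤₚ.<-≤-trans gt (weight-monoʳ-≤ n)) }) a
    -- At weight exactly `s` the climbing vertex fits neither outer layer strictly. Lowering the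
    -- centre along the constant coordinate makes the lower weights at most s + 1, still below k,
    -- and the upper ones at least s + 1, now above s.
    ... | tri≈ _ eq _ = t ∷ down i v , All.map
      (λ { (inj₁ (u , (st , q) , n , refl)) → let st′ , e = down-Step i st q in
             level t st′ (subst (λ x → x ℤ.< _) (sym e) (ℤₚ.≤-<-trans (ℤₚ.+-monoʳ-≤ 1ℤ (subst (λ x → weight v u ℤ.≤ x) eq (weight-monoʳ-≤ n))) 1+s<k))
         ; (inj₂ (u , (st , q) , n , refl)) → let st′ , e = down-Step i st q in
             above t st′ (subst (λ x → s ℤ.< x) (sym e) (≤⇒<suc (subst (λ x → x ℤ.≤ weight v u) eq (weight-monoʳ-≤ n)))) }) a

  -- A facet through `u` leaves one coordinate unraised, so `u` itself serves as centre, with the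
  -- summit at weight k. On an opposite facet that coordinate is raised throughout; moving the
  -- centre along with it makes all facet weights less than k and costs the summit one unit, and k -
  -- 1 > s by hypothesis.
  lid-Covered : ∀ M {u σ} → All (Step u) σ → Facet u 1 σ → Covered (summit M u ∷ map (+ M ∷_) σ)
  lid-Covered M {u} st (i , inj₁ q) = + M ∷ u ,
    above (+ M) (all-up-Step u) (subst (λ x → s ℤ.< x) (sym (weight-all-up u)) s<k) ∷
    Allₚ.map⁺ (All.zipWith (λ (r , e) → level (+ M) r (weight-< i r e)) (st , q))
  lid-Covered M {u} st (i , inj₂ q) = + M ∷ up i u ,
    (let r , e = up-Step i (all-up-Step u) (Vecₚ.lookup-map i (λ a → 1ℤ ℤ.+ a) u) in
     above (+ M) r (ℤₚ.≰⇒> λ le → ℤₚ.<⇒≱ 1+s<k (subst (λ x → x ℤ.≤ 1ℤ ℤ.+ s) (≡.trans e (weight-all-up u)) (ℤₚ.+-monoʳ-≤ 1ℤ le)))) ∷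
    Allₚ.map⁺ (All.zipWith (λ (r , e) →
      let r′ , e′ = up-Step i r (≡.trans e (ℤₚ.+-comm (lookup u i) 1ℤ)) in
      level (+ M) r′ (ℤₚ.suc[i]≤j⇒i<j (subst (λ x → x ℤ.≤ + k) (sym e′) (weight-≤ r)))) (st , q))

column-Step-from : ∀ {a : ℤ} {u : Point d} {σ} → All (Step u) σ → All (All (Step (a ∷ u))) (column a 1 σ)
column-Step-from p = Allₚ.++⁺ (prism-All (inj₁ refl ∷_) (inj₂ refl ∷_) p) []

at-Step-from : ∀ {a b : ℤ} {u : Point d} {z} → Step₁ a b → All (All (Step u)) z → All (All (Step (a ∷ u))) (at b z)
at-Step-from q ps = Allₚ.map⁺ (All.map (λ p → Allₚ.map⁺ (All.map (q ∷_) p)) ps)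

box-Step-from : (u : Point d) → All (All (Step u)) (box u 1)
box-Step-from []      = ([] ∷ []) ∷ []
box-Step-from (a ∷ u) = All-concatMap column-Step-from (box-Step-from u)

shell-Step-from : (u : Point d) → All (All (Step u)) (shell u 1)
shell-Step-from []      = [] ∷ []
shell-Step-from (a ∷ u) = Allₚ.++⁺ (at-Step-from (inj₁ refl) (box-Step-from u))
  (Allₚ.++⁺ (at-Step-from (inj₂ (ℤₚ.+-comm a 1ℤ)) (box-Step-from u)) (All-concatMap column-Step-from (shell-Step-from u)))

-- The parity contradiction over the dome

Far : ℕ → Point d → Set
Far {d} M x = Σ (Fin d) λ i → M ℕ.≤ ℤ.∣ lookup x i ∣

Extreme-Far : ∀ {M a} → Extreme M a → M ℕ.≤ ℤ.∣ a ∣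
Extreme-Far {M} (inj₁ refl) = ℕₚ.≤-reflexive (sym (ℤₚ.∣-i∣≡∣i∣ (+ M)))
Extreme-Far (inj₂ refl)     = ℕₚ.≤-refl

module _ (k : ℕ) (s : ℤ) (s≤k-2 : s ℤ.≤ + suc k ℤ.- + 2) (M : ℕ) where
  open Sandwich (suc k) s s≤k-2

  dome-Covered : All (λ σ → Covered σ × All (Far M) σ) (dome M (suc k))
  dome-Covered = Allₚ.++⁺
    (All-concatMap (λ { (st , i , a , e , p) → All.zip
       ( All-column (wall-Covered st p) 0ℤ M
       , All-column (λ b → prism-All (λ q → suc i , far e q) (λ q → suc i , far e q) p) 0ℤ M) })
      (All.zip (shell-Step (corner M (suc k)) (M ℕ.+ M) , sphere-OnWall M k)))
    (All-concatMap-universal (λ u → Allₚ.map⁺ (Allₚ.map⁺ (All.zipWith (λ {σ} (st , q) →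
        lid-Covered M st q , (zero , ℕₚ.n≤1+n M) ∷ Allₚ.map⁺ (All.universal (λ _ → zero , ℕₚ.≤-refl) σ))
        (shell-Step-from u , shell-Facet u 1))))
      (grid (corner M (suc k)) (M ℕ.+ M)))
    where
    far : ∀ {a b} → Extreme M a → b ≡ a → M ℕ.≤ ℤ.∣ b ∣
    far e refl = Extreme-Far e

  module _ (f : Point (suc (suc k)) → ℕ) (f-bounded : ∀ x → f x ℕ.< suc (suc k))
           (separated : ∀ x y → Far M x → Near x y → f x ≢ f (neg y)) where

    private
      apex = lower f ∘ centre
      value : ℕ → List (Point (suc (suc k))) → Bool
      value n σ = ev (alt true) (cone apex (upper f) n σ)

    -- On a wall at height 0 one coordinate is constant, so weights stay below k and the middle
    -- layer makes the first vertex of every face its centre; `cone-prism` then applies.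
    value-equator : ∀ {σ} → OnWall M σ → AllPairs Step σ → length σ ≡ suc k →
                    value (suc k) (map (0ℤ ∷_) σ) ≡ alternation true (f ∘ (0ℤ ∷_)) σ
    value-equator {σ} (i , a , _ , p) st len = ≡.trans
      (cone-prism centre (lower f) (upper f) {P = AllPairs (λ v u → Near u v)} faces-AllPairs
        (λ { (r ∷ _) → centre-head (Near-refl _ ∷ r) }) (suc k) (alt true) (alt-repeat true)
        (AllPairsₚ.map⁺ (zip-AllPairs (λ r q q′ → level 0ℤ r (weight-< i r (≡.trans q′ (sym q)))) st p))
        (≡.trans (Listₚ.length-map (0ℤ ∷_) σ) len))
      (cong (ev (alt true)) (prism-map (lower f) (upper f) (0ℤ ∷_) σ))
      where
      Near-refl : ∀ v → Near v v
      Near-refl (t ∷ v) = level t (Step-refl v) (weight-< zero (Step-refl v) refl)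

    f-antipodal : Antipodal M (f ∘ (0ℤ ∷_))
    f-antipodal {v} {u} i st q e = separated (0ℤ ∷ u) (0ℤ ∷ v)
      (suc i , subst (λ x → M ℕ.≤ ℤ.∣ x ∣) (sym q) (Extreme-Far e)) (level 0ℤ st (weight-< i st q))

    -- A cone word has one letter more than the simplex has vertices, hence one more than there are
    -- colours.
    cone-alt : ∀ {σ} → Covered σ × All (Far M) σ → length σ ≡ suc (suc k) → ∀ b →
               ev (alt b) (cone apex (upper f) (suc (suc k)) σ) ≡ false
    cone-alt {σ} c len b = ev-false (All.zipWith (λ { {w} (pr , bd , l) →
        alt-long b (suc (suc k)) (AllPairs-Proper pr) bd (ℕₚ.≤-reflexive (sym l)) })
      ( cone-AllPairs apex (upper f) {R = Apart} {P = λ σ → Covered σ × All (Far M) σ}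
          (λ { ((y , c) , far) → All.map (λ (c , far) → (y , c) , far) (All.zip (faces-All c , faces-All far)) })
          (λ { {σ} (c , far) → All.zipWith (λ (near , far) → minus-plus (separated _ (centre σ) far near)) (centre-covers c , far) })
          (λ σ ρ → minus-minus _ _) (λ v u → plus-plus _ _) (suc (suc k)) c
      , All.zip
          ( cone-All apex (upper f) (λ σ → subst (ℕ._< suc (suc k)) (sym (colour-minus _)) (f-bounded _))
              (suc (suc k)) (All.universal (λ x → subst (ℕ._< suc (suc k)) (sym (colour-plus _)) (f-bounded x)) σ)
          , cone-length apex (upper f) (suc (suc k)) len)))

    -- In the homotopy formula for cones all other terms vanish: cone words are too long to
    -- alternate, the `hi` face is all positive, and the flags of centres are all negative, so they
    -- cannot start with +.
    coboundary : ∀ {σ} → Covered σ × All (Far M) σ → length σ ≡ suc (suc k) → δ (value (suc k)) σ ≡ false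
    coboundary {σ} c len = begin
      δ (value (suc k)) σ
        ≡⟨ xor-identityʳ _ ⟨
      δ (value (suc k)) σ xor false
        ≡⟨ cong (δ (value (suc k)) σ xor_) (ev-false (All.zipWith (λ { (a , b) → alt-negative a b })
             (apices-All apex (upper f) (λ σ → sgn-minus (f (neg (centre σ)))) (suc (suc k)) σ , apices-nonempty apex (upper f) (suc k) σ))) ⟨
      δ (value (suc k)) σ xor ev (alt true) (apices apex (upper f) (suc (suc k)) σ)
        ≡⟨ cong (_xor (δ (value (suc k)) σ xor ev (alt true) (apices apex (upper f) (suc (suc k)) σ)))
             (alt-constant true (Allₚ.map⁺ (All.universal (λ v → sgn-plus (f v)) σ))
               (subst (2 ℕ.≤_) (sym (≡.trans (Listₚ.length-map (upper f) σ) len)) (s≤s (s≤s z≤n))) true) ⟨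
      alt true (map (upper f) σ) xor (δ (value (suc k)) σ xor ev (alt true) (apices apex (upper f) (suc (suc k)) σ))
        ≡⟨ δ-cone apex (upper f) (suc (suc k)) (alt true) σ len ⟨
      ev (δ (alt true)) (cone apex (upper f) (suc (suc k)) σ)
        ≡⟨ ev-cong (δ-alt true) (cone apex (upper f) (suc (suc k)) σ) ⟩
      ev (λ w → alt true w xor alt false w) (cone apex (upper f) (suc (suc k)) σ)
        ≡⟨ ev-xor (alt true) (alt false) (cone apex (upper f) (suc (suc k)) σ) ⟩
      ev (alt true) (cone apex (upper f) (suc (suc k)) σ) xor ev (alt false) (cone apex (upper f) (suc (suc k)) σ)
        ≡⟨ cong₂ _xor_ (cone-alt c len true) (cone-alt c len false) ⟩
      false ∎
      where open ≡-Reasoning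

    impossible : ⊥
    impossible = absurd true≡false
      where
      open ≡-Reasoning
      absurd : true ≡ false → ⊥
      absurd ()
      true≡false : true ≡ false
      true≡false = begin
        true
          ≡⟨ alternation-sphere M k (f ∘ (0ℤ ∷_)) f-antipodal ⟨
        ev (alternation true (f ∘ (0ℤ ∷_))) (sphere M (suc k))
          ≡⟨ ev-cong-All (All.zipWith (λ { (o , st , l) → value-equator o st l })
               (sphere-OnWall M k , All.zip (shell-Step (corner M (suc k)) (M ℕ.+ M) , shell-length (corner M (suc k)) (M ℕ.+ M)))) ⟨
        ev (value (suc k) ∘ map (0ℤ ∷_)) (sphere M (suc k))
          ≡⟨ ev-at (value (suc k)) 0ℤ (sphere M (suc k)) ⟨
        ev (value (suc k)) (at 0ℤ (sphere M (suc k)))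
          ≡⟨ ∂-dome M (suc k) (value (suc k)) ⟨
        ev (δ (value (suc k))) (dome M (suc k))
          ≡⟨ ev-false (All.zipWith (λ { (c , l) → coboundary c l }) (dome-Covered , dome-length M (suc k))) ⟩
        false ∎

-- From symmetric sets to colourings

¬¬-All : {P : A → Set} → (∀ x → ¬ ¬ P x) → ∀ xs → ¬ ¬ All P xs
¬¬-All f []       n = n []
¬¬-All f (x ∷ xs) n = f x λ p → ¬¬-All f xs λ ps → n (p ∷ ps)

norm : Point d → ℕ
norm []      = 0
norm (a ∷ v) = ℤ.∣ a ∣ ℕ.+ norm v

lookup≤norm : (v : Point d) (i : Fin d) → ℤ.∣ lookup v i ∣ ℕ.≤ norm v
lookup≤norm (a ∷ v) zero    = ℕₚ.m≤m+n _ _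
lookup≤norm (a ∷ v) (suc i) = ℕₚ.≤-trans (lookup≤norm v i) (ℕₚ.m≤n+m _ _)

bound : List (G k) → ℕ
bound []             = 1
bound ((t , v) ∷ xs) = norm (t ∷ v) ℕ.+ bound xs

norm<bound : ∀ {t} {v : Vec ℤ k} {xs} → (t , v) ∈ xs → norm (t ∷ v) ℕ.< bound xs
norm<bound {t = t} {v} {xs = _ ∷ xs} (here refl) = ℕₚ.≤-trans (ℕₚ.≤-reflexive (ℕₚ.+-comm 1 (norm (t ∷ v))))
  (ℕₚ.+-monoʳ-≤ (norm (t ∷ v)) (bound-positive xs))
  where
  bound-positive : (xs : List (G k)) → 1 ℕ.≤ bound xs
  bound-positive []       = ℕₚ.≤-refl
  bound-positive (x ∷ xs) = ℕₚ.≤-trans (bound-positive xs) (ℕₚ.m≤n+m _ _)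
norm<bound {xs = _ ∷ xs} (there i)   = ℕₚ.≤-trans (norm<bound i) (ℕₚ.m≤n+m _ _)

Far-∉ : ∀ {t} {v : Vec ℤ k} {xs} → Far (bound xs) (t ∷ v) → ¬ (t , v) ∈ xs
Far-∉ {t = t} {v} (i , p) j = ℕₚ.<⇒≱ (norm<bound j) (ℕₚ.≤-trans p (lookup≤norm (t ∷ v) i))

twice : Point d → Point d
twice = Vec.map (λ a → + 2 ℤ.* a)

Far-twice : ∀ {M} (x : Point d) → Far M x → Far M (twice x)
Far-twice x (i , p) = i , ℕₚ.≤-trans p (subst (ℤ.∣ lookup x i ∣ ℕ.≤_)
  (sym (≡.trans (cong ℤ.∣_∣ (Vecₚ.lookup-map i (λ a → + 2 ℤ.* a) x)) (ℤₚ.abs-* (+ 2) (lookup x i))))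
  (ℕₚ.m≤m+n _ _))

reflect-involutive : (c x : G k) → reflect c (reflect c x) ≡ x
reflect-involutive (t , v) (t′ , v′) = cong₂ _,_ (e t t′) (involutive v v′)
  where
  e : ∀ a b → + 2 ℤ.* a ℤ.- (+ 2 ℤ.* a ℤ.- b) ≡ b
  e = solve-∀
  involutive : ∀ {n} (v w : Vec ℤ n) →
               zipWith (λ a b → + 2 ℤ.* a ℤ.- b) v (zipWith (λ a b → + 2 ℤ.* a ℤ.- b) v w) ≡ w
  involutive []      []      = refl
  involutive (a ∷ v) (b ∷ w) = cong₂ _∷_ (e a b) (involutive v w)

-- The origin of the doubling: a sandwich point x - y becomes the centre of symmetry of the pair 2x,
-- -2y.
reflect-twice : ∀ t t′ (v v′ : Vec ℤ k) →
                reflect (t ℤ.- t′ , zipWith ℤ._-_ v v′) (+ 2 ℤ.* t , twice v) ≡ (+ 2 ℤ.* (ℤ.- t′) , twice (neg v′))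
reflect-twice t t′ v v′ = cong₂ _,_ (e t t′) (coordinates v v′)
  where
  e : ∀ a b → + 2 ℤ.* (a ℤ.- b) ℤ.- + 2 ℤ.* a ≡ + 2 ℤ.* (ℤ.- b)
  e = solve-∀
  coordinates : ∀ {n} (v w : Vec ℤ n) → zipWith (λ a b → + 2 ℤ.* a ℤ.- b) (zipWith ℤ._-_ v w) (twice v) ≡ twice (neg w)
  coordinates []      []      = refl
  coordinates (a ∷ v) (b ∷ w) = cong₂ _∷_ (e a b) (coordinates v w)

module _ (k : ℕ) (s : ℤ) (χ : G k → Fin (suc k)) where

  Exceptional : G k → Fin (suc k) → G k → Set
  Exceptional c i x = χ x ≡ i × χ (reflect c x) ≡ i

  -- For a centre c and a colour i, the points that share colour i with their reflection form a
  -- monochromatic symmetric set, so by assumption it is not infinite. There are finitely many pairs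
  -- (c, i), hence `¬¬-All` makes all these sets finite at once.
  exceptional-set : ¬ Σ (G k) (λ c → InSandwich k s c ×
                      Σ (G k → Set) (λ S → Infinite S × ConstantOn χ S × SymmetricAbout c S)) →
                    ¬ ¬ Σ (List (G k)) (λ xs → ∀ c → InSandwich k s c → ∀ x → χ x ≡ χ (reflect c x) → x ∈ xs)
  exceptional-set none n = ¬¬-All finite cases λ ps → n (union ps , covers ps)
    where
    Small : Point (suc k) × Fin (suc k) → Set
    Small (t ∷ v , i) = InSandwich k s (t , v) → Finite (Exceptional (t , v) i)
    cases = cartesianProduct (candidates k) (allFin (suc k))
    finite : ∀ p → ¬ ¬ Small p
    finite (t ∷ v , i) n with InSandwich? k s (t , v)
    ... | no ¬h = n (⊥-elim ∘ ¬h)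
    ... | yes h = none ((t , v) , h , Exceptional (t , v) i , (λ fin → n (λ _ → fin)) , (i , λ _ → proj₁) , λ x →
      (λ (a , b) → b , ≡.trans (cong χ (reflect-involutive (t , v) x)) a) ,
      (λ (a , b) → ≡.trans (cong χ (sym (reflect-involutive (t , v) x))) b , a))
    union : ∀ {ps} → All Small ps → List (G k)
    union []                           = []
    union {(t ∷ v , i) ∷ _} (q ∷ qs) with InSandwich? k s (t , v)
    ... | yes h = proj₁ (q h) ++ union qs
    ... | no _  = union qs
    union-∈ : ∀ {ps} (qs : All Small ps) {t v i} → (t ∷ v , i) ∈ ps → InSandwich k s (t , v) →
              ∀ x → Exceptional (t , v) i x → x ∈ union qs
    union-∈ {(t ∷ v , i) ∷ _} (q ∷ qs) j h x e with InSandwich? k s (t , v) | j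
    ... | yes h′ | here refl = ∈ₚ.∈-++⁺ˡ (proj₂ (q h′) x e)
    ... | no ¬h  | here refl = ⊥-elim (¬h h)
    ... | yes h′ | there j′  = ∈ₚ.∈-++⁺ʳ (proj₁ (q h′)) (union-∈ qs j′ h x e)
    ... | no _   | there j′  = union-∈ qs j′ h x e
    covers : ∀ (qs : All Small cases) c → InSandwich k s c → ∀ x → χ x ≡ χ (reflect c x) → x ∈ union qs
    covers qs (t , v) h x e = union-∈ qs
      (∈ₚ.∈-cartesianProduct⁺ (∈-candidates h) (∈ₚ.∈-allFin (χ x))) h x (refl , sym e)

theorem1p8 : (k : ℕ) (s : ℤ) → s ≤ (+ k) - (+ 2) → (χ : G k → Fin (suc k)) →
    ¬ ¬ Σ (G k) (λ c → InSandwich k s c ×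
    Σ (G k → Set) (λ S → Infinite S × ConstantOn χ S × SymmetricAbout c S))
theorem1p8 zero s s≤ χ none = none
  -- For k = 0 there is one colour and s is negative. The sandwich is then the single point 1, and
  -- the whole of ℤ is symmetric about it.
  ( (1ℤ , []) , (VAll.[] , inj₂ (inj₂ (refl , ℤₚ.≤-<-trans s≤ ℤ.-<+))) , (λ _ → ⊤)
  , (λ (xs , p) → Far-∉ {t = + bound xs} {[]} {xs} (zero , ℕₚ.≤-refl) (p _ tt))
  , (zero , λ x _ → only (χ x)) , λ x → (λ _ → tt) , (λ _ → tt))
  where
  only : (i : Fin 1) → i ≡ zero
  only zero = refl
theorem1p8 (suc k) s s≤ χ none = exceptional-set (suc k) s χ none λ (xs , exceptional) →
  -- `bound xs` exceeds the norm of every exceptional point, so a point with a coordinate of that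
  -- size is not exceptional, and doubling only moves it farther out.
  impossible k s s≤ (bound xs) f (λ { (t ∷ v) → Finₚ.toℕ<n _ })
    (λ { (t ∷ v) (t′ ∷ v′) far near e → Far-∉ (Far-twice (t ∷ v) far)
      (exceptional (t ℤ.- t′ , zipWith ℤ._-_ v v′) near (+ 2 ℤ.* t , twice v)
        (≡.trans (Finₚ.toℕ-injective e) (cong χ (sym (reflect-twice t t′ v v′))))) })
  where
  f : Point (suc (suc k)) → ℕ
  f (t ∷ v) = Fin.toℕ (χ (+ 2 ℤ.* t , twice v))
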